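{- Let $\ell\ge3$ and let $\lambda$ be a partition. Then $\mathcal S\lambda$ is the unique smallest partition in its regularization class $\mathcal{RC}(\lambda)$ with respect to dominance order. It can be characterized as the unique partition in its regularization class all of whose boxes are locked.
   Context: Positions $(a,b)$, $a,b\ge1$, are in row $a$ (rows numbered downward) and column $b$. The ladder of $(a,b)$ is the set of all positions $(c,d)$, $c,d\ge 1$, with $c-a=(\ell-1)(b-d)$. The regularization $\mathcal R\lambda$ of a partition $\lambda$ is the partition obtained by moving all boxes of $\lambda$ up to the top of their respective ladders (so each ladder contains the same number of boxes, placed in its highest positions). The regularization class of $\lambda$ is $\mathcal{RC}(\lambda)=\{\mu:\mathcal R\mu=\mathcal R\lambda\}$. Dominance order on partitions of $n$: $\lambda\le\mu$ if $\sum_{j\le i}\lambda_j\le\sum_{j\le i}\mu_j$ for all $i$. Locked boxes of $\lambda$ are determined by the following procedure (the set of locked boxes is the smallest set closed under these rules): (I) if a box $x$ of $\lambda$ lies in the first row or has a locked box directly above it, and every unoccupied position in the same ladder as $x$ lying below $x$ has an unoccupied position directly above it, then $x$ is locked; (II) if a box $y$ is locked, then every box to the left of $y$ in the same row is locked. Boxes of $\lambda$ that are not locked are unlocked. $\mathcal S\lambda$ is the diagram obtained from $\lambda$ by keeping all locked boxes in place and moving all unlocked boxes down their ladders as far as possible, keeping them in order: on each ladder, the unlocked boxes are moved to the lowest positions of that ladder not occupied by locked boxes. -}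

module Defs where

open import Level using (Level)
open import Data.Nat using (ℕ; zero; suc; _+_; _*_; _∸_; _≤_; _<_; _≥_; _≟_; _≤?_; _<?_; s≤s)
open import Data.Nat.Properties
open import Data.List.Base using (List; []; _∷_; length; filter; map; take; upTo)
open import Data.Nat.ListAction using (sum)
open import Data.List.Relation.Unary.All using (All)
open import Data.List.Relation.Unary.Linked using (Linked)
open import Data.List.Relation.Unary.Unique.Propositional using (Unique)
import Data.List.Relation.Unary.Unique.Propositional.Properties as Uniqueₚ
open import Data.List.Membership.Propositional using (_∈_)
open import Data.List.Membership.Propositional.Properties
  using (∈-map⁺; ∈-map⁻; ∈-filter⁺; ∈-filter⁻; ∈-upTo⁺)
open import Data.Product using (∃; _×_; _,_; proj₁; proj₂)
open import Data.Sum using (_⊎_; inj₁; inj₂)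
open import Relation.Nullary using (¬_; Dec)
open import Relation.Nullary.Decidable using (map′; _×-dec_; _→-dec_; ¬?)
open import Relation.Unary using (Pred; Decidable; _≐_)
open import Relation.Binary.Core using (Rel)
open import Relation.Binary.PropositionalEquality

record Partition : Set where
  constructor mkPartition
  field
    parts      : List ℕ
    decreasing : Linked _≥_ parts
    positive   : All (0 <_) parts

open Partition public

size : Partition → ℕ
size α = sum (parts α)

nth : List ℕ → ℕ → ℕ
nth []       _       = 0
nth (x ∷ xs) zero    = x
nth (x ∷ xs) (suc i) = nth xs i

-- Rows and columns are counted from 0, so (a , b) is the position in row
-- a + 1 and column b + 1.  Rows are numbered downward.
Position : Set
Position = ℕ × ℕ

row col : Position → ℕ
row = proj₁
col = proj₂

-- A diagram is a set of positions; two diagrams are identified by _≐_.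
Diagram : Set₁
Diagram = Pred Position Level.zero

Box : Partition → Diagram
Box α (a , b) = b < nth (parts α) a

box? : ∀ α → Decidable (Box α)
box? α (a , b) = b <? nth (parts α) a

-- Dominance compares only partitions of the same number.
infix 4 _⊴_
_⊴_ : Partition → Partition → Set
α ⊴ β = size α ≡ size β × (∀ i → sum (take i (parts α)) ≤ sum (take i (parts β)))

module _ (ℓ : ℕ) where

  ladderIndex : Position → ℕ
  ladderIndex (a , b) = a + (ℓ ∸ 1) * b

  -- The equation c - a = (ℓ - 1)(b - d) with all subtractions moved across;
  -- it is unaffected by counting rows and columns from 0.
  SameLadder : Position → Position → Set
  SameLadder (a , b) (c , d) = c + (ℓ ∸ 1) * d ≡ a + (ℓ ∸ 1) * b

  -- The positions of the ladder of p, one per column, from the lowest to the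
  -- highest; ∈-ladder⁺, ∈-ladder⁻ and ladder-unique below confirm that this
  -- lists each position of the ladder exactly once when ℓ ≥ 2.
  ladder : Position → List Position
  ladder p = map (λ d → (ladderIndex p ∸ (ℓ ∸ 1) * d , d))
                 (filter (λ d → (ℓ ∸ 1) * d ≤? ladderIndex p) (upTo (suc (ladderIndex p))))

  ∈-ladder⁺ : 2 ≤ ℓ → ∀ {p q} → SameLadder p q → q ∈ ladder p
  ∈-ladder⁺ (s≤s (s≤s {n = k} _)) {p} {c , d} eq =
    subst (λ x → (x , d) ∈ ladder p) row-eq
      (∈-map⁺ _ (∈-filter⁺ (λ e → (ℓ ∸ 1) * e ≤? ladderIndex p) (∈-upTo⁺ (s≤s d≤K)) md≤K))
    where
    md≤K : (ℓ ∸ 1) * d ≤ ladderIndex p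
    md≤K = subst ((ℓ ∸ 1) * d ≤_) eq (m≤n+m _ c)
    d≤K : d ≤ ladderIndex p
    d≤K = ≤-trans (m≤n*m d (suc k)) md≤K
    row-eq : ladderIndex p ∸ (ℓ ∸ 1) * d ≡ c
    row-eq = trans (cong (_∸ (ℓ ∸ 1) * d) (sym eq)) (m+n∸n≡m c ((ℓ ∸ 1) * d))

  ∈-ladder⁻ : ∀ {p q} → q ∈ ladder p → SameLadder p q
  ∈-ladder⁻ {p} q∈ with ∈-map⁻ _ q∈
  ... | d , d∈ , refl = m∸n+n≡m (proj₂ (∈-filter⁻ (λ e → (ℓ ∸ 1) * e ≤? ladderIndex p) d∈))

  ladder-unique : ∀ p → Unique (ladder p)
  ladder-unique p = Uniqueₚ.map⁺ (cong proj₂)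
    (Uniqueₚ.filter⁺ (λ e → (ℓ ∸ 1) * e ≤? ladderIndex p) (Uniqueₚ.upTo⁺ _))

  -- Each ladder holds as many boxes as in α, in its highest positions: p is
  -- occupied when fewer positions of its ladder lie above p than α has boxes
  -- on that ladder.
  𝓡 : Partition → Diagram
  𝓡 α p = length (filter (λ q → row q <? row p) (ladder p))
        < length (filter (box? α) (ladder p))

  𝓡𝓒 : Partition → Pred Partition _
  𝓡𝓒 α μ = 𝓡 μ ≐ 𝓡 α

  module _ (α : Partition) where

    -- A position of the ladder of x below x is never in the first row, so it
    -- has the form (suc c , d), and (c , d) is the position directly above it.
    GapsContinueUp : Position → Set
    GapsContinueUp x = ∀ {c d} → SameLadder x (suc c , d) → row x < suc c →
                       ¬ Box α (suc c , d) → ¬ Box α (c , d)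

    data Locked : Pred Position Level.zero where
      first-row    : ∀ {b} → Box α (0 , b) → GapsContinueUp (0 , b) → Locked (0 , b)
      below-locked : ∀ {a b} → Box α (suc a , b) → Locked (a , b) →
                     GapsContinueUp (suc a , b) → Locked (suc a , b)
      left-of      : ∀ {a b d} → Locked (a , b) → d < b → Locked (a , d)

    locked⇒box : ∀ {p} → Locked p → Box α p
    locked⇒box (first-row x _)      = x
    locked⇒box (below-locked x _ _) = x
    locked⇒box (left-of l d<b)      = <-trans d<b (locked⇒box l)

    gapsContinueUp? : Decidable GapsContinueUp
    gapsContinueUp? x@(a , b) = map′ to from
      (allUpTo? (λ c → allUpTo? (λ d →
        (c + (ℓ ∸ 1) * d ≟ a + (ℓ ∸ 1) * b) →-dec ((a <? c) →-dec ok? c d)) b)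
        (suc (ladderIndex x)))
      where
      OK : ℕ → ℕ → Set
      OK c d = ¬ Box α (c , d) → ¬ Box α (c ∸ 1 , d)
      ok? : ∀ c d → Dec (OK c d)
      ok? c d = ¬? (box? α (c , d)) →-dec ¬? (box? α (c ∸ 1 , d))
      Bounded : Set
      Bounded = ∀ {c} → c < suc (ladderIndex x) → ∀ {d} → d < b →
                SameLadder x (c , d) → a < c → OK c d
      to : Bounded → GapsContinueUp x
      to h {c} {d} eq a<c = h (s≤s (subst (suc c ≤_) eq (m≤m+n (suc c) _)))
        (*-cancelˡ-< (ℓ ∸ 1) d b (≰⇒> λ mb≤md →
          <-irrefl (sym eq) (+-mono-<-≤ a<c mb≤md)))
        eq a<c
      from : GapsContinueUp x → Bounded
      from g {zero}  _ _ _  ()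
      from g {suc c} _ _ eq a<c = g eq a<c

    lockedAt? : ∀ a b → Dec (Locked (a , b))
    lockedAt? zero b = map′ to from
      (anyUpTo? (λ e → (b ≤? e) ×-dec gapsContinueUp? (0 , e)) (nth (parts α) 0))
      where
      Witness : ℕ → Set
      Witness b = ∃ λ e → e < nth (parts α) 0 × b ≤ e × GapsContinueUp (0 , e)
      to : Witness b → Locked (0 , b)
      to (e , e∈ , b≤e , g) with m≤n⇒m<n∨m≡n b≤e
      ... | inj₁ b<e  = left-of (first-row e∈ g) b<e
      ... | inj₂ refl = first-row e∈ g
      from : ∀ {b} → Locked (0 , b) → Witness b
      from (first-row x g) = _ , x , ≤-refl , g
      from (left-of l d<b) with from l
      ... | e , e∈ , b≤e , g = e , e∈ , ≤-trans (<⇒≤ d<b) b≤e , g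
    lockedAt? (suc a) b = map′ to from
      (anyUpTo? (λ e → (b ≤? e) ×-dec (lockedAt? a e ×-dec gapsContinueUp? (suc a , e)))
        (nth (parts α) (suc a)))
      where
      Witness : ℕ → Set
      Witness b = ∃ λ e → e < nth (parts α) (suc a) × b ≤ e × Locked (a , e) ×
                          GapsContinueUp (suc a , e)
      to : Witness b → Locked (suc a , b)
      to (e , e∈ , b≤e , l , g) with m≤n⇒m<n∨m≡n b≤e
      ... | inj₁ b<e  = left-of (below-locked e∈ l g) b<e
      ... | inj₂ refl = below-locked e∈ l g
      from : ∀ {b} → Locked (suc a , b) → Witness b
      from (below-locked x l g) = _ , x , ≤-refl , l , g
      from (left-of l d<b) with from l
      ... | e , e∈ , b≤e , w = e , e∈ , ≤-trans (<⇒≤ d<b) b≤e , w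

    locked? : Decidable Locked
    locked? (a , b) = lockedAt? a b

    AllLocked : Set
    AllLocked = ∀ {p} → Box α p → Locked p

    -- Locked boxes stay.  A position that is not locked is occupied when fewer
    -- non-locked positions of its ladder lie below it than the ladder has
    -- unlocked boxes.
    𝓢 : Diagram
    𝓢 p = Locked p ⊎
          (¬ Locked p ×
           length (filter (λ q → (row p <? row q) ×-dec ¬? (locked? q)) (ladder p))
           < length (filter (λ q → box? α q ×-dec ¬? (locked? q)) (ladder p)))

module _ {a p : Level} {A : Set a} where

  IsUnique : Pred A p → Pred A _
  IsUnique P x = P x × (∀ y → P y → y ≡ x)

  Smallest : ∀ {r} → Rel A r → Pred A p → Pred A _
  Smallest _≼_ P x = P x × (∀ y → P y → x ≼ y)

{-# OPTIONS --safe #-}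

-- Call a locked box hard if some position of its ladder below it is empty, and
-- call all other boxes soft.  If a hard box had an unlocked position just above
-- it in its ladder, then the m = ℓ - 1 rows ending in its row would have locked
-- parts of equal length, and the gap rule for their last locked boxes would
-- propagate the empty position up to the hard box itself.  Hence the hard boxes
-- form the top of their ladder, and 𝓢 α consists of the hard boxes together with
-- the soft boxes of each ladder sunk to its bottom.  The number of soft boxes
-- does not increase from a ladder with an empty position to the next ladder, so
-- 𝓢 α is the diagram of a partition; all of its boxes are again locked.
--
-- Conversely let σ have only locked boxes, and let μ have as many boxes as σ on
-- each ladder.  By induction on the row, and from right to left within a row,
-- counting boxes on two consecutive ladders shows that every hard box of σ lies
-- in μ.  As the other boxes of σ are at the bottom of their ladders, σ lies below
-- μ ladder by ladder, hence in dominance order.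
module Submission where

open import Defs
open import Level using (Level)
open import Data.Nat
open import Data.Nat.Properties
open import Data.Nat.ListAction using (sum)
open import Algebra.Properties.CommutativeSemigroup +-commutativeSemigroup using (interchange)
open import Data.Empty using (⊥)
open import Data.List.Base using (List; []; _∷_; _++_; length; filter; map; take; upTo)
open import Data.List.Properties using (upTo-∷ʳ; filter-++; map-++; length-++; take-all)
open import Data.List.Relation.Unary.All as All using (All; []; _∷_)
open import Data.List.Relation.Unary.Linked as Linked using (Linked; []; [-]; _∷_)
open import Data.Product using (∃; Σ-syntax; _×_; _,_; proj₁; proj₂)
open import Data.Sum using (_⊎_; inj₁; inj₂; [_,_]′)
open import Function using (_∘_)
open import Relation.Nullary using (¬_; Dec; yes; no; contradiction)
open import Relation.Nullary.Decidable using (map′; _×-dec_; _⊎-dec_; ¬?; decidable-stable)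
open import Relation.Unary using (Pred; Decidable; _≐_)
open import Relation.Binary.PropositionalEquality

-- Finite sums and counting

private variable
  p q : Level
  n t : ℕ

Σ< : ℕ → (ℕ → ℕ) → ℕ
Σ< zero    f = 0
Σ< (suc n) f = Σ< n f + f n

Σ-mono-≤ : ∀ n {f g} → (∀ d → d < n → f d ≤ g d) → Σ< n f ≤ Σ< n g
Σ-mono-≤ zero    f≤g = z≤n
Σ-mono-≤ (suc n) f≤g = +-mono-≤ (Σ-mono-≤ n (λ d d<n → f≤g d (m<n⇒m<1+n d<n))) (f≤g n ≤-refl)

Σ-cong : ∀ n {f g} → (∀ d → d < n → f d ≡ g d) → Σ< n f ≡ Σ< n g
Σ-cong zero    f≡g = refl
Σ-cong (suc n) f≡g = cong₂ _+_ (Σ-cong n (λ d d<n → f≡g d (m<n⇒m<1+n d<n))) (f≡g n ≤-refl)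

Σ-mono-< : ∀ n {f g} → (∀ d → d < n → f d ≤ g d) →
           ∀ {d₀} → d₀ < n → f d₀ < g d₀ → Σ< n f < Σ< n g
Σ-mono-< (suc n) f≤g d₀<1+n lt with m<1+n⇒m<n∨m≡n d₀<1+n
... | inj₁ d₀<n = +-mono-<-≤ (Σ-mono-< n (λ d d<n → f≤g d (m<n⇒m<1+n d<n)) d₀<n lt) (f≤g n ≤-refl)
... | inj₂ refl = +-mono-≤-< (Σ-mono-≤ n (λ d d<n → f≤g d (m<n⇒m<1+n d<n))) lt

Σ-0 : ∀ n → Σ< n (λ _ → 0) ≡ 0
Σ-0 zero    = refl
Σ-0 (suc n) = trans (+-identityʳ _) (Σ-0 n)

Σ-+ : ∀ n f g → Σ< n (λ d → f d + g d) ≡ Σ< n f + Σ< n g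
Σ-+ zero    f g = refl
Σ-+ (suc n) f g =
  trans (cong (_+ (f n + g n)) (Σ-+ n f g)) (interchange (Σ< n f) (Σ< n g) (f n) (g n))

Σ-swap : ∀ n k (f : ℕ → ℕ → ℕ) →
         Σ< n (λ i → Σ< k (λ j → f i j)) ≡ Σ< k (λ j → Σ< n (λ i → f i j))
Σ-swap zero    k f = sym (Σ-0 k)
Σ-swap (suc n) k f = trans (cong (_+ Σ< k (f n)) (Σ-swap n k f)) (sym (Σ-+ k _ _))

Σ-++ : ∀ n k f → Σ< (n + k) f ≡ Σ< n f + Σ< k (λ j → f (n + j))
Σ-++ n zero    f = trans (cong (λ x → Σ< x f) (+-identityʳ n)) (sym (+-identityʳ _))
Σ-++ n (suc k) f = begin
  Σ< (n + suc k) f                                        ≡⟨ cong (λ x → Σ< x f) (+-suc n k) ⟩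
  Σ< (n + k) f + f (n + k)                                ≡⟨ cong (_+ f (n + k)) (Σ-++ n k f) ⟩
  Σ< n f + Σ< k (λ j → f (n + j)) + f (n + k)             ≡⟨ +-assoc (Σ< n f) _ _ ⟩
  Σ< n f + Σ< (suc k) (λ j → f (n + j))                   ∎
  where open ≡-Reasoning

Σ-stable : ∀ {n N f} → n ≤ N → (∀ d → n ≤ d → f d ≡ 0) → Σ< N f ≡ Σ< n f
Σ-stable {n} {N} {f} n≤N f≡0 = begin
  Σ< N f                                     ≡⟨ cong (λ x → Σ< x f) (m+[n∸m]≡n n≤N) ⟨
  Σ< (n + (N ∸ n)) f                         ≡⟨ Σ-++ n (N ∸ n) f ⟩
  Σ< n f + Σ< (N ∸ n) (λ j → f (n + j))      ≡⟨ cong (Σ< n f +_)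
                                                  (Σ-cong (N ∸ n) (λ j _ → f≡0 (n + j) (m≤m+n n j))) ⟩
  Σ< n f + Σ< (N ∸ n) (λ _ → 0)              ≡⟨ cong (Σ< n f +_) (Σ-0 (N ∸ n)) ⟩
  Σ< n f + 0                                 ≡⟨ +-identityʳ _ ⟩
  Σ< n f                                     ∎
  where open ≡-Reasoning

module _ {p} {P : Set p} where

  𝟙 : Dec P → ℕ
  𝟙 (yes _) = 1
  𝟙 (no  _) = 0

  𝟙≤1 : (P? : Dec P) → 𝟙 P? ≤ 1
  𝟙≤1 (yes _) = ≤-refl
  𝟙≤1 (no  _) = z≤n

  𝟙-yes : (P? : Dec P) → P → 𝟙 P? ≡ 1
  𝟙-yes (yes _) _ = refl
  𝟙-yes (no ¬p) p = contradiction p ¬p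

  𝟙-no : (P? : Dec P) → ¬ P → 𝟙 P? ≡ 0
  𝟙-no (yes p) ¬p = contradiction p ¬p
  𝟙-no (no _)  _  = refl

𝟙-mono : ∀ {P : Set p} {Q : Set q} (P? : Dec P) (Q? : Dec Q) → (P → Q) → 𝟙 P? ≤ 𝟙 Q?
𝟙-mono (yes p) Q? f = ≤-reflexive (sym (𝟙-yes Q? (f p)))
𝟙-mono (no _)  Q? f = z≤n

𝟙-cong : ∀ {P : Set p} {Q : Set q} (P? : Dec P) (Q? : Dec Q) → (P → Q) → (Q → P) → 𝟙 P? ≡ 𝟙 Q?
𝟙-cong P? Q? f g = ≤-antisym (𝟙-mono P? Q? f) (𝟙-mono Q? P? g)

𝟙-strict : ∀ {P : Set p} {Q : Set q} (P? : Dec P) (Q? : Dec Q) → ¬ P → Q → 𝟙 P? < 𝟙 Q?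
𝟙-strict P? Q? ¬p q = subst₂ _<_ (sym (𝟙-no P? ¬p)) (sym (𝟙-yes Q? q)) (s≤s z≤n)

count : ∀ {P : Pred ℕ p} → Decidable P → ℕ → ℕ
count P? n = Σ< n (λ d → 𝟙 (P? d))

module _ {p q} {P : Pred ℕ p} {Q : Pred ℕ q} (P? : Decidable P) (Q? : Decidable Q) where

  count-mono : ∀ n → (∀ d → d < n → P d → Q d) → count P? n ≤ count Q? n
  count-mono n P⇒Q = Σ-mono-≤ n (λ d d<n → 𝟙-mono (P? d) (Q? d) (P⇒Q d d<n))

  count-cong : ∀ n → (∀ d → d < n → P d → Q d) → (∀ d → d < n → Q d → P d) →
               count P? n ≡ count Q? n
  count-cong n P⇒Q Q⇒P = Σ-cong n (λ d d<n → 𝟙-cong (P? d) (Q? d) (P⇒Q d d<n) (Q⇒P d d<n))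

  count-strict : ∀ n → (∀ d → d < n → P d → Q d) → ∀ {d₀} → d₀ < n → ¬ P d₀ → Q d₀ →
                 count P? n < count Q? n
  count-strict n P⇒Q {d₀} d₀<n ¬p q =
    Σ-mono-< n (λ d d<n → 𝟙-mono (P? d) (Q? d) (P⇒Q d d<n)) d₀<n (𝟙-strict (P? d₀) (Q? d₀) ¬p q)

module _ {p q r} {P : Pred ℕ p} {Q : Pred ℕ q} {R : Pred ℕ r}
         (P? : Decidable P) (Q? : Decidable Q) (R? : Decidable R) where

  count-⊎ : ∀ n → (∀ d → d < n → R d → P d ⊎ Q d) → (∀ d → d < n → P d → R d) →
            (∀ d → d < n → Q d → R d) → (∀ d → d < n → P d → ¬ Q d) →
            count R? n ≡ count P? n + count Q? n
  count-⊎ n split P⇒R Q⇒R disjoint = trans (Σ-cong n pointwise) (Σ-+ n _ _)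
    where
    pointwise : ∀ d → d < n → 𝟙 (R? d) ≡ 𝟙 (P? d) + 𝟙 (Q? d)
    pointwise d d<n with P? d | Q? d | R? d
    ... | yes p | yes q | _     = contradiction q (disjoint d d<n p)
    ... | yes p | no _  | yes _ = refl
    ... | yes p | no _  | no ¬r = contradiction (P⇒R d d<n p) ¬r
    ... | no _  | yes q | yes _ = refl
    ... | no _  | yes q | no ¬r = contradiction (Q⇒R d d<n q) ¬r
    ... | no ¬p | no ¬q | yes r = contradiction (split d d<n r) [ ¬p , ¬q ]′
    ... | no _  | no _  | no _  = refl

module _ {p} {P : Pred ℕ p} (P? : Decidable P) where

  count≤n : ∀ n → count P? n ≤ n
  count≤n zero    = z≤n
  count≤n (suc n) = ≤-trans (+-mono-≤ (count≤n n) (𝟙≤1 (P? n))) (≤-reflexive (+-comm n 1))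

  count-all : ∀ n → (∀ d → d < n → P d) → count P? n ≡ n
  count-all zero    _   = refl
  count-all (suc n) all =
    trans (cong₂ _+_ (count-all n (λ d d<n → all d (m<n⇒m<1+n d<n))) (𝟙-yes (P? n) (all n ≤-refl)))
          (+-comm n 1)

  count-stable : ∀ {n N} → n ≤ N → (∀ d → P d → d < n) → count P? N ≡ count P? n
  count-stable n≤N P⇒< =
    Σ-stable n≤N (λ d n≤d → 𝟙-no (P? d) (λ p → <⇒≱ (P⇒< d p) n≤d))

  count-stable′ : ∀ {n N} → (∀ d → P d → d < n) → (∀ d → P d → d < N) → count P? N ≡ count P? n
  count-stable′ {n} {N} P⇒<n P⇒<N with ≤-total n N
  ... | inj₁ n≤N = count-stable n≤N P⇒<n
  ... | inj₂ N≤n = sym (count-stable N≤n P⇒<N)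

  count≤bound : ∀ n → (∀ d → P d → d < t) → count P? n ≤ t
  count≤bound {t = t} n P⇒<t with ≤-total t n
  ... | inj₁ t≤n = ≤-trans (≤-reflexive (count-stable t≤n P⇒<t)) (count≤n t)
  ... | inj₂ n≤t = ≤-trans (count≤n n) n≤t

  bound≤count : t ≤ n → (∀ d → d < t → P d) → t ≤ count P? n
  bound≤count {t} {n} t≤n all = begin
    t                                                ≡⟨ count-all t all ⟨
    count P? t                                       ≤⟨ m≤m+n _ _ ⟩
    count P? t + Σ< (n ∸ t) (λ j → 𝟙 (P? (t + j)))   ≡⟨ Σ-++ t (n ∸ t) _ ⟨
    count P? (t + (n ∸ t))                           ≡⟨ cong (count P?) (m+[n∸m]≡n t≤n) ⟩
    count P? n                                       ∎
    where open ≤-Reasoning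

count-< : t ≤ n → count (_<? t) n ≡ t
count-< {t} {n} t≤n =
  ≤-antisym (count≤bound (_<? t) n (λ _ d<t → d<t)) (bound≤count (_<? t) t≤n (λ _ d<t → d<t))

count-≡≤1 : ∀ d₀ n → count (_≟ d₀) n ≤ 1
count-≡≤1 d₀ n with d₀ <? n
... | no d₀≮n = ≤-trans (≤-reflexive (trans
  (Σ-cong n (λ d d<n → 𝟙-no (d ≟ d₀) (λ { refl → d₀≮n d<n }))) (Σ-0 n)))
  z≤n
... | yes d₀<n = +-cancelˡ-≤ d₀ _ _ (begin
  d₀ + count (_≟ d₀) n                    ≡⟨ cong (_+ count (_≟ d₀) n) (count-< (<⇒≤ d₀<n)) ⟨
  count (_<? d₀) n + count (_≟ d₀) n      ≡⟨ count-⊎ (_<? d₀) (_≟ d₀) (_<? suc d₀) n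
                                               (λ _ _ → m<1+n⇒m<n∨m≡n) (λ _ _ → m<n⇒m<1+n)
                                               (λ { _ _ refl → ≤-refl }) (λ _ _ lt eq → <-irrefl eq lt) ⟨
  count (_<? suc d₀) n                    ≡⟨ count-< d₀<n ⟩
  suc d₀                                  ≡⟨ +-comm 1 d₀ ⟩
  d₀ + 1                                  ∎)
  where open ≤-Reasoning

1≤count-≡ : ∀ {d₀ n} → d₀ < n → 1 ≤ count (_≟ d₀) n
1≤count-≡ {d₀} {n} d₀<n = ≤-trans (s≤s z≤n)
  (Σ-mono-< n {f = λ _ → 0} (λ _ _ → z≤n) d₀<n (≤-reflexive (sym (𝟙-yes (d₀ ≟ d₀) refl))))

-- Adding the indicator of `d₁` on one side and that of `d₀` on the other makes the comparison hold
-- termwise: the one element that `P` may have and `Q` lack is paid for by `d₁`.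
count-exchange : ∀ {P : Pred ℕ p} {Q : Pred ℕ q} (P? : Decidable P) (Q? : Decidable Q) {n d₀ d₁} →
                 (∀ d → P d → ¬ Q d → d ≡ d₀) → d₁ < n → Q d₁ → ¬ P d₁ →
                 count P? n ≤ count Q? n
count-exchange P? Q? {n} {d₀} {d₁} exc d₁<n Qd₁ ¬Pd₁ = +-cancelʳ-≤ 1 _ _ (begin
  count P? n + 1                          ≤⟨ +-monoʳ-≤ _ (1≤count-≡ d₁<n) ⟩
  count P? n + count (_≟ d₁) n            ≡⟨ Σ-+ n _ _ ⟨
  Σ< n (λ d → 𝟙 (P? d) + 𝟙 (d ≟ d₁))      ≤⟨ Σ-mono-≤ n (λ d _ → pointwise d) ⟩
  Σ< n (λ d → 𝟙 (Q? d) + 𝟙 (d ≟ d₀))      ≡⟨ Σ-+ n _ _ ⟩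
  count Q? n + count (_≟ d₀) n            ≤⟨ +-monoʳ-≤ _ (count-≡≤1 d₀ n) ⟩
  count Q? n + 1                          ∎)
  where
  open ≤-Reasoning
  pointwise : ∀ d → 𝟙 (P? d) + 𝟙 (d ≟ d₁) ≤ 𝟙 (Q? d) + 𝟙 (d ≟ d₀)
  pointwise d with d ≟ d₁ | P? d | Q? d
  ... | yes refl | yes p | _     = contradiction p ¬Pd₁
  ... | yes refl | no _  | no ¬q = contradiction Qd₁ ¬q
  ... | yes refl | no _  | yes _ = s≤s z≤n
  ... | no _     | no _  | _     = z≤n
  ... | no _     | yes _ | yes _ = s≤s z≤n
  ... | no _     | yes p | no ¬q = ≤-reflexive (sym (𝟙-yes (d ≟ d₀) (exc d p ¬q)))

-- Locked boxes in ladder coordinates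

module Ladders (m : ℕ) .{{_ : NonZero m}} where

  private variable
    k k′ b d e : ℕ

  -- As `m` is at least 1, column `d` meets ladder `k` only for `d ≤ k`; hence counts along ladder
  -- `k` run over the columns below `suc k`.
  index-bound : m * d ≤ k → d < suc k
  index-bound {d} v = s≤s (≤-trans (m≤n*m d m) v)

  index-right : ∀ a b → m + (a + m * b) ≡ a + m * suc b
  index-right a b = begin
    m + (a + m * b) ≡⟨ +-assoc m a (m * b) ⟨
    m + a + m * b   ≡⟨ cong (_+ m * b) (+-comm m a) ⟩
    a + m + m * b   ≡⟨ +-assoc a m (m * b) ⟩
    a + (m + m * b) ≡⟨ cong (a +_) (*-suc m b) ⟨
    a + m * suc b   ∎
    where open ≡-Reasoning

  *-left : m * suc d ≤ m + k → m * d ≤ k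
  *-left {d} v = +-cancelˡ-≤ m _ _ (≤-trans (≤-reflexive (sym (*-suc m d))) v)

  *-down : e ≤ d → m * d ≤ k → m * e ≤ k
  *-down e≤d v = ≤-trans (*-monoʳ-≤ m e≤d) v

  -- A position of ladder `suc k` further left is strictly lower, hence not in the first row, so the
  -- position above it exists on ladder `k`.
  *-gap : d < e → m * e ≤ suc k → m * d ≤ k
  *-gap {d} {e} d<e v = s≤s⁻¹ (≤-trans (*-monoʳ-< m d<e) v)

  -- (k , d) stands for the position in column d of the k-th ladder, that is, in
  -- row k - m d, where m = ℓ - 1; it exists when m d ≤ k.  The position above it
  -- is (k - 1 , d), the one to its right is (m + k , suc d), and the positions
  -- of its ladder below it are the (k , e) with e < d.
  record Shape : Set₁ where
    field
      X     : ℕ → ℕ → Set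
      X?    : ∀ k d → Dec (X k d)
      valid : X k d → m * d ≤ k
      up    : X (suc k) d → m * d ≤ k → X k d
      left  : X (m + k) (suc d) → X k d

    boxes : ℕ → ℕ
    boxes k = count (X? k) (suc k)

    GapBelow : ℕ → ℕ → Set
    GapBelow k b = ∃ λ d → d < b × ¬ X k d

    gapBelow? : ∀ k b → Dec (GapBelow k b)
    gapBelow? k = anyUpTo? (λ d → ¬? (X? k d))

    noGapBelow : ¬ GapBelow k b → d < b → X k d
    noGapBelow ¬g d<b = decidable-stable (X? _ _) (λ ¬x → ¬g (_ , d<b , ¬x))

    -- In `GapBelow` the position in column `d` exists as soon as `(k , b)` does. Here existence
    -- must be required, because `X k d` also fails where ladder `k` has no position.
    Gap : ℕ → Set
    Gap k = ∃ λ d → d < suc k × (m * d ≤ k × ¬ X k d)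

    gap? : ∀ k → Dec (Gap k)
    gap? k = anyUpTo? (λ d → (m * d ≤? k) ×-dec ¬? (X? k d)) (suc k)

    noGap : ¬ Gap k → m * d ≤ k → X k d
    noGap ¬g v = decidable-stable (X? _ _) (λ ¬x → ¬g (_ , index-bound v , v , ¬x))

    gapBelow-suc : m * b ≤ suc k → GapBelow k b → GapBelow (suc k) b
    gapBelow-suc v (d , d<b , ¬x) = d , d<b , λ x → ¬x (up x (*-gap d<b v))

    gap-suc : Gap k → Gap (suc k)
    gap-suc (d , d<1+k , v , ¬x) = d , m<n⇒m<1+n d<1+k , m≤n⇒m≤1+n v , λ x → ¬x (up x v)

    gap-+ : ∀ i → Gap k → Gap (i + k)
    gap-+ zero    g = g
    gap-+ (suc i) g = gap-suc (gap-+ i g)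

    GapsUp : ℕ → ℕ → Set
    GapsUp k b = ∀ {d} → d < b → ¬ X (suc k) d → ¬ X k d

  -- The properties of locked boxes on which the argument rests. In `L-end` the box is the last
  -- locked one in its row, so rule (I) must have locked it. In `L-intro` the premise on `L k b` is
  -- void for a box in the first row.
  record Locking : Set₁ where
    field
      shape : Shape
    open Shape shape public
    field
      L       : ℕ → ℕ → Set
      L?      : ∀ k d → Dec (L k d)
      L⇒X     : L k d → X k d
      L-up    : L (suc k) d → m * d ≤ k → L k d
      L-left  : L (m + k) (suc d) → L k d
      L-end   : L (suc k) b → ¬ L (m + suc k) (suc b) → GapsUp k b
      L-intro : X (suc k) b → (m * b ≤ k → L k b) → GapsUp k b → L (suc k) b

    L-up-≤ : k ≤ k′ → L k′ b → m * b ≤ k → L k b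
    L-up-≤ {k} {k′} k≤k′ l v with m≤n⇒m<n∨m≡n k≤k′
    L-up-≤ {k} {suc k′} _ l v | inj₁ (s≤s k≤k′) = L-up-≤ k≤k′ (L-up l (≤-trans v k≤k′)) v
    ... | inj₂ refl = l

    -- Hard boxes: locked boxes that sinking in their ladder would move.
    H : ℕ → ℕ → Set
    H k b = L k b × GapBelow k b

    H? : ∀ k b → Dec (H k b)
    H? k b = L? k b ×-dec gapBelow? k b

    H⇒X : H k b → X k b
    H⇒X (l , _) = L⇒X l

    -- Were the conclusion false, the locked parts of the m rows ending in row
    -- k - m b would all end in column b, so a gap (m + j , d) would propagate
    -- upward to (j , d), and then to its right neighbour (m + j , suc d),
    -- eventually reaching the box (k , b).
    H⇒L-right : H k b → m * suc b ≤ suc k → L (suc k) (suc b)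
    H⇒L-right {k} {b} (l , d₀ , d₀<b , ¬x₀) v = decidable-stable (L? _ _) (λ ¬l → absurd ¬l)
      where
      m≤k : m ≤ k
      m≤k = s≤s⁻¹ (begin
        suc m       ≡⟨ +-comm 1 m ⟩
        m + 1       ≤⟨ +-monoʳ-≤ m (≤-trans (≤-trans (s≤s z≤n) d₀<b) (m≤n*m b m)) ⟩
        m + m * b   ≡⟨ *-suc m b ⟨
        m * suc b   ≤⟨ v ⟩
        suc k       ∎)
        where open ≤-Reasoning
      absurd : ¬ L (suc k) (suc b) → ⊥
      absurd ¬l with m≤n⇒∃[o]m+o≡n m≤k
      ... | j , refl = march (b ∸ d₀) (m∸n+n≡m (<⇒≤ d₀<b)) ¬x₀
        where
        m*b≤1+j : m * b ≤ suc j
        m*b≤1+j = *-left (≤-trans v (≤-reflexive (sym (+-suc m j))))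
        lift : ∀ i → i ≤ m → d < b → ¬ X (i + j) d → ¬ X j d
        lift zero    _   _   ¬x = ¬x
        lift (suc i) i<m d<b ¬x = lift i (<⇒≤ i<m) d<b
          (L-end (L-up-≤ (+-monoˡ-≤ j i<m) l (≤-trans m*b≤1+j (s≤s (m≤n+m j i))))
                 (λ l′ → ¬l (L-up-≤ le l′ v)) d<b ¬x)
          where
          le : suc (m + j) ≤ m + suc (i + j)
          le = ≤-trans (≤-reflexive (sym (+-suc m j))) (+-monoʳ-≤ m (s≤s (m≤n+m j i)))
        march : ∀ n {d} → n + d ≡ b → ¬ X (m + j) d → ⊥
        march zero    refl ¬x = ¬x (L⇒X l)
        march (suc n) {d} eq ¬x = march n (trans (+-suc n d) eq)
          (λ x → lift m ≤-refl (≤-trans (s≤s (m≤n+m d n)) (≤-reflexive eq)) ¬x (left x))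

    H-right : H k b → m * suc b ≤ suc k → H (suc k) (suc b)
    H-right h@(_ , g) v with gapBelow-suc (*-down (n≤1+n _) v) g
    ... | d , d<b , ¬x = H⇒L-right h v , d , m<n⇒m<1+n d<b , ¬x

    -- One column at a time: `H⇒L-right` locks `(suc k , suc b′)`, and `L-up` returns to
    -- `(k , suc b′)` on the original ladder. The gap stays where it was.
    H-raise : ∀ {b b′} → H k b → b ≤ b′ → m * b′ ≤ k → H k b′
    H-raise {b = b} {b′} h b≤b′ v with m≤n⇒m<n∨m≡n b≤b′
    ... | inj₂ refl = h
    H-raise {b = b} {suc b′} h b≤b′ v | inj₁ (s≤s b≤b″) with H-raise h b≤b″ (*-down (n≤1+n _) v)
    ... | h′@(_ , d , d<b , ¬x) =
      L-up (H⇒L-right h′ (m≤n⇒m≤1+n v)) v , d , m<n⇒m<1+n d<b , ¬x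

    H-step : ∀ {b b′} → H k b → b < b′ → m * b′ ≤ suc k → H (suc k) b′
    H-step h b<b′ v = H-raise (H-right h (*-down b<b′ v)) b<b′ v

    -- Soft boxes and their number on consecutive ladders

    Soft : ℕ → ℕ → Set
    Soft k d = X k d × ¬ H k d

    soft? : ∀ k d → Dec (Soft k d)
    soft? k d = X? k d ×-dec ¬? (H? k d)

    soft-bound : Soft k d → d < suc k
    soft-bound (x , _) = index-bound (valid x)

    h : ℕ → ℕ
    h k = count (soft? k) (suc k)

    h-valid : d < h k → m * d ≤ k
    h-valid {d} {k} d<h = ≮⇒≥ (λ k<md → <⇒≱ d<h (count≤bound (soft? k) (suc k)
      (λ e (x , _) → *-cancelˡ-< m e d (≤-<-trans (valid x) k<md))))

    -- The columns up to `d` are all occupied and none has a gap below it, so they hold `suc d` soft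
    -- boxes.
    noGapBelow⇒<h : X k d → ¬ GapBelow k d → d < h k
    noGapBelow⇒<h {k} {d} x ¬g = bound≤count (soft? k) (index-bound (valid x))
      (λ e e≤d → full e e≤d , λ (_ , f , f<e , ¬x) → ¬g (f , <-≤-trans f<e (s≤s⁻¹ e≤d) , ¬x))
      where
      full : ∀ e → e < suc d → X k e
      full e e<1+d with m<1+n⇒m<n∨m≡n e<1+d
      ... | inj₁ e<d  = noGapBelow ¬g e<d
      ... | inj₂ refl = x

    noGap⇒<h : ¬ Gap k → m * d ≤ k → d < h k
    noGap⇒<h ¬g v = noGapBelow⇒<h (noGap ¬g v)
      (λ (e , e<d , ¬x) → ¬x (noGap ¬g (*-down (<⇒≤ e<d) v)))

    -- At most one soft box (suc k , d₀) fails to have a soft box above it; it is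
    -- not locked although everything above it is, so some gap (suc k , d₁) has
    -- a soft box above it, which compensates for d₀.
    h-suc-≤ : Gap k → h (suc k) ≤ h k
    h-suc-≤ {k} (g , g<1+k , vg , ¬xg) = decidable-stable (h (suc k) ≤? h k) absurd
      where
      h-k : h k ≡ count (soft? k) (suc (suc k))
      h-k = sym (count-stable (soft? k) (n≤1+n _) (λ _ → soft-bound))

      Bad : ℕ → Set
      Bad d = Soft (suc k) d × ¬ Soft k d

      bad⇒H : Bad d → m * d ≤ k → H k d
      bad⇒H ((x , _) , ¬s) v = decidable-stable (H? _ _) (λ ¬h → ¬s (up x v , ¬h))

      -- A bad box has a hard box above it, and `H-step` would then make every higher box of ladder
      -- `suc k` hard.
      bad-not-above : Bad d → Bad e → ¬ d < e
      bad-not-above {d} {e} bd ((xe , ¬he) , _) d<e =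
        ¬he (H-step (bad⇒H bd (*-gap d<e (valid xe))) d<e (valid xe))

      bad-unique : Bad d → Bad e → e ≡ d
      bad-unique bd be = ≤-antisym (≮⇒≥ (bad-not-above bd be)) (≮⇒≥ (bad-not-above be bd))

      gapBelow-bad : Bad d → GapBelow (suc k) d
      gapBelow-bad {d} bd@((x , _) , _) with m * d ≤? k
      ... | yes v = gapBelow-suc (valid x) (proj₂ (bad⇒H bd v))
      -- Here the bad box is in the first row. The gap assumed on ladder `k` then lies in a column
      -- to its left, as `m * g ≤ k < m * d`.
      ... | no ¬v = gapBelow-suc (valid x) (g , *-cancelˡ-< m g d (≤-<-trans vg (≰⇒> ¬v)) , ¬xg)

      absurd : ¬ ¬ h (suc k) ≤ h k
      absurd ¬le with anyUpTo? (λ d → soft? (suc k) d ×-dec ¬? (soft? k d)) (suc (suc k))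
      ... | no none = ¬le (≤-trans
        (count-mono (soft? (suc k)) (soft? k) _ (λ d d<n s →
          decidable-stable (soft? k d) (λ ¬s → none (d , d<n , s , ¬s))))
        (≤-reflexive (sym h-k)))
      ... | yes (d₀ , _ , bad@((x₀ , ¬h₀) , _)) =
        ¬h₀ (L-intro x₀ (λ v → proj₁ (bad⇒H bad v)) gapsUp , gapBelow-bad bad)
        where
        gapsUp : GapsUp k d₀
        gapsUp {d₁} d₁<d₀ ¬x₁ x₁ = ¬le (≤-trans
          (count-exchange (soft? (suc k)) (soft? k) (λ d s ¬s → bad-unique bad (s , ¬s))
            (m<n⇒m<1+n (index-bound (valid x₁)))
            (x₁ , λ h₁ → ¬h₀ (H-step h₁ d₁<d₀ (valid x₀)))
            (λ (x , _) → ¬x₁ x))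
          (≤-reflexive (sym h-k)))

    h-+-≤ : ∀ i → Gap k → h (i + k) ≤ h k
    h-+-≤ zero    g = ≤-refl
    h-+-≤ (suc i) g = ≤-trans (h-suc-≤ (gap-+ i g)) (h-+-≤ i g)

    -- Hard boxes form the top of their ladder, so pushing the unlocked boxes down
    -- collects all soft boxes at the bottom; Y is the resulting diagram 𝓢.
    Y : ℕ → ℕ → Set
    Y k d = H k d ⊎ d < h k

    Y? : ∀ k d → Dec (Y k d)
    Y? k d = H? k d ⊎-dec (d <? h k)

    Y-valid : Y k d → m * d ≤ k
    Y-valid = [ (λ h → valid (H⇒X h)) , h-valid ]′

    L⇒Y : L k d → Y k d
    L⇒Y {k} {d} l with gapBelow? k d
    ... | yes g = inj₁ (l , g)
    ... | no ¬g = inj₂ (noGapBelow⇒<h (L⇒X l) ¬g)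

    -- For a sunk box there are two cases: if ladder `k` has a gap, `h` does not increase from it to
    -- the next ladder; if it is full, all of its boxes are soft and sinking leaves it full.
    -- `Y-left` does the same across `m` ladders.
    Y-up : Y (suc k) d → m * d ≤ k → Y k d
    Y-up (inj₁ (l , _)) v = L⇒Y (L-up l v)
    Y-up {k} (inj₂ d<h) v with gap? k
    ... | yes g = inj₂ (<-≤-trans d<h (h-suc-≤ g))
    ... | no ¬g = inj₂ (noGap⇒<h ¬g v)

    Y-left : Y (m + k) (suc d) → Y k d
    Y-left (inj₁ (l , _)) = L⇒Y (L-left l)
    Y-left {k} (inj₂ 1+d<h) with gap? k
    ... | yes g = inj₂ (<-≤-trans (<⇒≤ 1+d<h) (h-+-≤ m g))
    ... | no ¬g = inj₂ (noGap⇒<h ¬g (*-left (h-valid 1+d<h)))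

    -- By `H-raise` every soft box lies below a hard one, so fewer than `suc d` columns are left for
    -- soft boxes. This makes the two alternatives of `Y` exclusive.
    H⇒h≤ : H k d → h k ≤ d
    H⇒h≤ {k} {d} hd = count≤bound (soft? k) (suc k)
      (λ e (x , ¬h) → ≰⇒> (λ d≤e → ¬h (H-raise hd d≤e (valid x))))

    Y-shape : Shape
    Y-shape = record { X = Y ; X? = Y? ; valid = Y-valid ; up = Y-up ; left = Y-left }

    Y-boxes : ∀ k → Shape.boxes Y-shape k ≡ boxes k
    Y-boxes k = begin
      count (Y? k) (suc k)                              ≡⟨ count-⊎ (H? k) (_<? h k) (Y? k) (suc k)
                                                             (λ _ _ y → y) (λ _ _ → inj₁) (λ _ _ → inj₂)
                                                             (λ _ _ hd → ≤⇒≯ (H⇒h≤ hd)) ⟩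
      count (H? k) (suc k) + count (_<? h k) (suc k)    ≡⟨ cong (count (H? k) (suc k) +_) (count-< (count≤n (soft? k) (suc k))) ⟩
      count (H? k) (suc k) + h k                        ≡⟨ count-⊎ (H? k) (soft? k) (X? k) (suc k)
                                                             split (λ _ _ → H⇒X) (λ _ _ → proj₁)
                                                             (λ _ _ hd (_ , ¬hd) → ¬hd hd) ⟨
      count (X? k) (suc k)                              ∎
      where
      open ≡-Reasoning
      split : ∀ d → d < suc k → X k d → H k d ⊎ Soft k d
      split d _ x with H? k d
      ... | yes hd = inj₁ hd
      ... | no ¬hd = inj₂ (x , ¬hd)

    -- The gap rule for the last box of a row of `Y`. Below a sunk box there is no gap. A hard box
    -- is the last locked one of its row, so `L-end` gives the gap rule for `X`; it remains to carry
    -- this over to `Y`, separately for the hard and the sunk boxes of ladder `k`.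
    Y-locked : Y (suc k) b → ¬ Y (m + suc k) (suc b) → Shape.GapsUp Y-shape k b
    Y-locked {k} {b} y ¬yr {d} d<b ¬yd = refute y
      where
      refute : Y (suc k) b → ¬ Y k d
      refute (inj₂ b<h) _ = ¬yd (inj₂ (<-trans d<b b<h))
      refute (inj₁ (lb , f , f<b , ¬xf)) = [ hard , soft ]′
        where
        gapsUp : GapsUp k b
        gapsUp = L-end lb (λ l → ¬yr (L⇒Y l))
        hard : ¬ H k d
        hard (l , g) with X? (suc k) d
        ... | no ¬x = gapsUp d<b ¬x (L⇒X l)
        ... | yes x = ¬yd (L⇒Y (L-intro x (λ _ → l) (λ e<d → gapsUp (<-trans e<d d<b))))
        H-down : m * b ≤ k → H k b
        H-down v = L-up lb v , f , f<b , gapsUp f<b ¬xf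
        -- From column `b` on, the boxes of ladder `k` are hard. Left of `b`, gaps continue upward,
        -- so a soft box of ladder `k` has a box below it, which is soft too: its gap would give one
        -- on ladder `k`.
        keep : ∀ e → Soft k e → Soft (suc k) e
        keep e (x , ¬h) with e <? b
        ... | no e≮b = contradiction
          (H-raise (H-down (*-down (≮⇒≥ e≮b) (valid x))) (≮⇒≥ e≮b) (valid x)) ¬h
        ... | yes e<b =
          decidable-stable (X? (suc k) e) (λ ¬x → gapsUp e<b ¬x x) ,
          λ (l , i , i<e , ¬xi) → ¬h (L-up l (valid x) , i , i<e , gapsUp (<-trans i<e e<b) ¬xi)
        h≤ : h k ≤ h (suc k)
        h≤ = ≤-trans (≤-reflexive (sym (count-stable (soft? k) (n≤1+n _) (λ _ → soft-bound))))
                     (count-mono (soft? k) (soft? (suc k)) _ (λ e _ → keep e))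
        soft : ¬ d < h k
        soft d<h = ¬yd (inj₂ (<-≤-trans d<h h≤))

    -- Agreement of `Y` with the counting description of `𝓢`

    Unlocked : ℕ → ℕ → Set
    Unlocked k e = X k e × ¬ L k e

    unlocked? : ∀ k e → Dec (Unlocked k e)
    unlocked? k e = X? k e ×-dec ¬? (L? k e)

    FreeBelow : ℕ → ℕ → ℕ → Set
    FreeBelow k d e = e < d × ¬ L k e

    freeBelow? : ∀ k d e → Dec (FreeBelow k d e)
    freeBelow? k d e = (e <? d) ×-dec ¬? (L? k e)

    module _ {k d} (v : m * d ≤ k) (¬l : ¬ L k d) where

      private
        LB LS : ℕ → Set
        LB e = e < d × L k e
        LS e = L k e × ¬ H k e
        LB? : ∀ e → Dec (LB e)
        LB? e = (e <? d) ×-dec L? k e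
        LS? : ∀ e → Dec (LS e)
        LS? e = L? k e ×-dec ¬? (H? k e)

        d≡ : d ≡ count (freeBelow? k d) (suc k) + count LB? (suc k)
        d≡ = trans (sym (count-< (<⇒≤ (index-bound v))))
          (count-⊎ (freeBelow? k d) LB? (_<? d) (suc k) split (λ _ _ → proj₁) (λ _ _ → proj₁)
            (λ _ _ (_ , ¬l′) (_ , l′) → ¬l′ l′))
          where
          split : ∀ e → e < suc k → e < d → FreeBelow k d e ⊎ LB e
          split e _ e<d with L? k e
          ... | yes l′ = inj₂ (e<d , l′)
          ... | no ¬l′ = inj₁ (e<d , ¬l′)

        h≡ : h k ≡ count (unlocked? k) (suc k) + count LS? (suc k)
        h≡ = count-⊎ (unlocked? k) LS? (soft? k) (suc k) split
          (λ _ _ (x , ¬l′) → x , λ hd → ¬l′ (proj₁ hd)) (λ _ _ (l′ , ¬hd) → L⇒X l′ , ¬hd)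
          (λ _ _ (_ , ¬l′) (l′ , _) → ¬l′ l′)
          where
          split : ∀ e → e < suc k → Soft k e → Unlocked k e ⊎ LS e
          split e _ (x , ¬hd) with L? k e
          ... | yes l′ = inj₂ (l′ , ¬hd)
          ... | no ¬l′ = inj₁ (x , ¬l′)

      -- By `d≡` and `h≡`, the number `d` counts the free and the locked positions (`LB`) below
      -- `(k , d)`, and `h k` the unlocked boxes and the locked soft ones (`LS`). If no box of `LS`
      -- lies above `d`, then `LS` is contained in `LB` and cancelling suffices.
      Y⇒fewer : Y k d → count (freeBelow? k d) (suc k) < count (unlocked? k) (suc k)
      Y⇒fewer (inj₁ (l , _)) = contradiction l ¬l
      Y⇒fewer (inj₂ d<h) with anyUpTo? (λ e → LS? e ×-dec (d <? e)) (suc k)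
      ... | no none = +-cancelʳ-< (count LB? (suc k)) _ _ (begin-strict
        count (freeBelow? k d) (suc k) + count LB? (suc k)   ≡⟨ d≡ ⟨
        d                                                    <⟨ d<h ⟩
        h k                                                  ≡⟨ h≡ ⟩
        count (unlocked? k) (suc k) + count LS? (suc k)      ≤⟨ +-monoʳ-≤ (count (unlocked? k) (suc k))
                                                                  (count-mono LS? LB? (suc k) LS⇒LB) ⟩
        count (unlocked? k) (suc k) + count LB? (suc k)      ∎)
        where
        open ≤-Reasoning
        LS⇒LB : ∀ e → e < suc k → LS e → LB e
        LS⇒LB e e<1+k ls@(l , _) = ≤∧≢⇒< (≮⇒≥ (λ d<e → none (e , e<1+k , ls , d<e)))
                                          (λ { refl → ¬l l }) , l
      -- A locked box above `d` that is not hard has no gap below it, so the free positions below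
      -- `d` are unlocked boxes, and `(k , d)` is one more.
      ... | yes (e , _ , (l , ¬he) , d<e) =
        count-strict (freeBelow? k d) (unlocked? k) (suc k)
          (λ f _ (f<d , ¬lf) → full (<-trans f<d d<e) , ¬lf)
          (index-bound v) (λ (d<d , _) → <-irrefl refl d<d) (full d<e , ¬l)
        where
        full : ∀ {f} → f < e → X k f
        full = noGapBelow (λ g → ¬he (l , g))

      -- A locked box below `(k , d)` is not hard, since `H-raise` would lock `(k , d)`; so `LB` is
      -- contained in `LS`.
      fewer⇒Y : count (freeBelow? k d) (suc k) < count (unlocked? k) (suc k) → Y k d
      fewer⇒Y lt = inj₂ (begin-strict
        d                                                    ≡⟨ d≡ ⟩
        count (freeBelow? k d) (suc k) + count LB? (suc k)   <⟨ +-mono-<-≤ lt (count-mono LB? LS? (suc k) LB⇒LS) ⟩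
        count (unlocked? k) (suc k) + count LS? (suc k)      ≡⟨ h≡ ⟨
        h k                                                  ∎)
        where
        open ≤-Reasoning
        LB⇒LS : ∀ e → e < suc k → LB e → LS e
        LB⇒LS e _ (e<d , l) = l , λ he → ¬l (proj₁ (H-raise he (<⇒≤ e<d) v))

  -- Comparison of an all-locked shape with any shape having the same ladder counts

  module _ (S : Locking) (X⇒L : ∀ {k d} → Locking.X S k d → Locking.L S k d)
           (B : ℕ) (X-bound : ∀ {k d} → Locking.X S k d → d < B)
           (T : Shape) (boxes≡ : ∀ k → Locking.boxes S k ≡ Shape.boxes T k) where

    open Locking S
    open Shape T using ()
      renaming (X to X′; X? to X′?; boxes to boxes′; valid to valid′; up to up′; left to left′)

    private
      -- If (suc k , b) were not in X′, then comparing column by column would give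
      -- #X′ (suc k) + #X k < #X (suc k) + #X′ k, where #X k counts the ladder k.
      end-case : ∀ {k b} → H (suc k) b → ¬ X (m + suc k) (suc b) →
                 (∀ {e} → b ≤ e → H k e → X′ k e) → X′ (suc k) b
      end-case {k} {b} hb@(l , (g , g<b , ¬xg)) ¬xr ih = decidable-stable (X′? (suc k) b) absurd
        where
        gapsUp : GapsUp k b
        gapsUp = L-end l (λ lr → ¬xr (L⇒X lr))
        b<n : b < suc (suc k)
        b<n = index-bound (valid (L⇒X l))
        absurd : ¬ ¬ X′ (suc k) b
        absurd ¬x′ = <-irrefl eq (Σ-mono-< (suc (suc k)) (λ e _ → pointwise e) b<n
          (+-mono-<-≤ (𝟙-strict (X′? (suc k) b) (X? (suc k) b) ¬x′ (L⇒X l)) (above b ≤-refl)))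
          where
          above : ∀ e → b ≤ e → 𝟙 (X? k e) ≤ 𝟙 (X′? k e)
          above e b≤e = 𝟙-mono (X? k e) (X′? k e) (λ x →
            ih b≤e (H-raise (L-up l (*-down b≤e (valid x)) , g , g<b , gapsUp g<b ¬xg) b≤e (valid x)))
          pointwise : ∀ e → 𝟙 (X′? (suc k) e) + 𝟙 (X? k e) ≤ 𝟙 (X? (suc k) e) + 𝟙 (X′? k e)
          pointwise e with e <? b
          ... | no e≮b = +-mono-≤
            (𝟙-mono (X′? (suc k) e) (X? (suc k) e) (λ x′ → H⇒X (H-raise hb (≮⇒≥ e≮b) (valid′ x′))))
            (above e (≮⇒≥ e≮b))
          ... | yes e<b = ≤-trans (≤-reflexive (+-comm (𝟙 (X′? (suc k) e)) _)) (+-mono-≤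
            (𝟙-mono (X? k e) (X? (suc k) e) (λ x →
              decidable-stable (X? (suc k) e) (λ ¬x → gapsUp e<b ¬x x)))
            (𝟙-mono (X′? (suc k) e) (X′? k e) (λ x′ →
              up′ x′ (*-gap e<b (valid (L⇒X l))))))
          shrink : count (X? k) (suc (suc k)) ≡ count (X′? k) (suc (suc k))
          shrink = trans (count-stable (X? k) (n≤1+n _) (λ _ x → index-bound (valid x)))
            (trans (boxes≡ k) (sym (count-stable (X′? k) (n≤1+n _) (λ _ x → index-bound (valid′ x)))))
          eq : Σ< (suc (suc k)) (λ e → 𝟙 (X′? (suc k) e) + 𝟙 (X? k e)) ≡
               Σ< (suc (suc k)) (λ e → 𝟙 (X? (suc k) e) + 𝟙 (X′? k e))
          eq = trans (Σ-+ (suc (suc k)) _ _)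
            (trans (cong₂ _+_ (sym (boxes≡ (suc k))) shrink) (sym (Σ-+ (suc (suc k)) _ _)))

      -- The bound on `k` places the box in row `a` or above, and `n` bounds the number of columns
      -- from `b` up to `B`. If the right neighbour is a box, it is hard as well, its gap being
      -- shifted one column right, and `left′` brings membership in `X′` back. Otherwise the row
      -- ends and `end-case` applies.
      H⇒X′-row : ∀ a → (∀ {k b} → k < a + m * b → H k b → X′ k b) →
                 ∀ n {k b} → k < suc a + m * b → B ≤ n + b → H k b → X′ k b
      H⇒X′-row a ih zero    _ B≤b hb = contradiction (X-bound (H⇒X hb)) (≤⇒≯ B≤b)
      H⇒X′-row a ih (suc n) {k} {b} k<  B≤ hb@(l , g , g<b , ¬xg) with X? (m + k) (suc b)
      ... | yes xr = left′ (H⇒X′-row a ih n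
              (≤-trans (+-monoʳ-< m k<) (≤-reflexive (index-right (suc a) b)))
              (≤-trans B≤ (≤-reflexive (sym (+-suc n b))))
              (X⇒L xr , suc g , s≤s g<b , λ x → ¬xg (left x)))
      H⇒X′-row a ih (suc n) {zero} {b} _ _ (l , _ , g<b , _) | no _ =
        contradiction (≤-trans g<b (≤-trans (m≤n*m b m) (valid (L⇒X l)))) (λ ())
      H⇒X′-row a ih (suc n) {suc k} {b} k< _ hb | no ¬xr =
        -- From column `b` on, the positions of ladder `k` lie in rows strictly above that of
        -- `(suc k , b)`.
        end-case hb ¬xr (λ b≤e → ih (<-≤-trans (s≤s⁻¹ k<) (+-monoʳ-≤ a (*-monoʳ-≤ m b≤e))))

      H⇒X′-below : ∀ a {k b} → k < a + m * b → H k b → X′ k b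
      H⇒X′-below zero    k<mb hb = contradiction (valid (H⇒X hb)) (<⇒≱ k<mb)
      H⇒X′-below (suc a) k<   hb = H⇒X′-row a (H⇒X′-below a) B k< (m≤m+n B _) hb

    H⇒X′ : ∀ {k b} → H k b → X′ k b
    H⇒X′ {k} = H⇒X′-below (suc k) (s≤s (m≤m+n k _))

    -- If all boxes of `X` in `R` are hard, they lie in `X′`. Otherwise some box `e₀` in `R` has no
    -- gap below it, so `X` fills the part of the ladder outside `R`; `X′` has no more boxes there,
    -- and the totals agree.
    count-top : ∀ k {R : ℕ → Set} (R? : Decidable R) → (∀ {d e} → d ≤ e → R d → R e) →
                count (λ e → X? k e ×-dec R? e) (suc k) ≤ count (λ e → X′? k e ×-dec R? e) (suc k)
    count-top k R? R-up with anyUpTo? (λ e → (X? k e ×-dec R? e) ×-dec ¬? (H? k e)) (suc k)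
    ... | no none = count-mono (λ e → X? k e ×-dec R? e) (λ e → X′? k e ×-dec R? e) (suc k)
      (λ e e<n (x , r) → H⇒X′ (decidable-stable (H? k e) (λ ¬h → none (e , e<n , (x , r) , ¬h))) , r)
    ... | yes (e₀ , _ , (x₀ , r₀) , ¬h₀) = +-cancelʳ-≤ (boxes k) _ _ (begin
      count XR? (suc k) + boxes k                           ≡⟨ cong (count XR? (suc k) +_) (boxes≡ k) ⟩
      count XR? (suc k) + boxes′ k                          ≡⟨ Σ-+ (suc k) _ _ ⟨
      Σ< (suc k) (λ e → 𝟙 (XR? e) + 𝟙 (X′? k e))            ≤⟨ Σ-mono-≤ (suc k) (λ e _ → pointwise e) ⟩
      Σ< (suc k) (λ e → 𝟙 (X′R? e) + 𝟙 (X? k e))            ≡⟨ Σ-+ (suc k) _ _ ⟩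
      count X′R? (suc k) + boxes k                          ∎)
      where
      open ≤-Reasoning
      XR? : ∀ e → Dec _
      XR? e = X? k e ×-dec R? e
      X′R? : ∀ e → Dec _
      X′R? e = X′? k e ×-dec R? e
      pointwise : ∀ e → 𝟙 (XR? e) + 𝟙 (X′? k e) ≤ 𝟙 (X′R? e) + 𝟙 (X? k e)
      pointwise e with R? e
      ... | yes r = ≤-trans (≤-reflexive (+-comm _ (𝟙 (X′? k e))))
        (+-mono-≤ (𝟙-mono (X′? k e) (X′? k e ×-dec yes r) (λ x′ → x′ , r))
                  (𝟙-mono (X? k e ×-dec yes r) (X? k e) proj₁))
      ... | no ¬r = +-mono-≤
        (𝟙-mono (X? k e ×-dec no ¬r) (X′? k e ×-dec no ¬r) (λ (_ , r) → contradiction r ¬r))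
        (𝟙-mono (X′? k e) (X? k e) (λ _ → noGapBelow
          (λ g → ¬h₀ (X⇒L x₀ , g)) (≰⇒> (λ e₀≤e → ¬r (R-up e₀≤e r₀)))))

-- Partitions and their ladders

module _ {P : ℕ → Set} (P? : Decidable P) (P-down : ∀ {d e} → e ≤ d → P d → P e)
         {n} (P-bound : ∀ {d} → P d → d < n) where

  <count⇒ : ∀ {d} → d < count P? n → P d
  <count⇒ {d} d<c = decidable-stable (P? d) (λ ¬p → <⇒≱ d<c (count≤bound P? n
    (λ e p → ≰⇒> (λ d≤e → ¬p (P-down d≤e p)))))

  ⇒<count : ∀ {d} → P d → d < count P? n
  ⇒<count p = bound≤count P? (P-bound p) (λ e e≤d → P-down (s≤s⁻¹ e≤d) p)

module _ {A : Set} {P : A → Set} {Q : ℕ → Set} (P? : Decidable P) (Q? : Decidable Q) (f : ℕ → A) where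

  length-filter-upTo : ∀ n → length (filter P? (map f (filter Q? (upTo n)))) ≡
                             count (λ d → Q? d ×-dec P? (f d)) n
  length-filter-upTo zero    = refl
  length-filter-upTo (suc n) = begin
    length (filter P? (map f (filter Q? (upTo (suc n)))))
      ≡⟨ cong (λ xs → length (filter P? (map f (filter Q? xs)))) (upTo-∷ʳ n) ⟨
    length (filter P? (map f (filter Q? (upTo n ++ n ∷ []))))
      ≡⟨ cong (λ xs → length (filter P? (map f xs))) (filter-++ Q? (upTo n) _) ⟩
    length (filter P? (map f (filter Q? (upTo n) ++ filter Q? (n ∷ []))))
      ≡⟨ cong (λ xs → length (filter P? xs)) (map-++ f (filter Q? (upTo n)) _) ⟩
    length (filter P? (map f (filter Q? (upTo n)) ++ map f (filter Q? (n ∷ []))))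
      ≡⟨ cong length (filter-++ P? (map f (filter Q? (upTo n))) _) ⟩
    length (filter P? (map f (filter Q? (upTo n))) ++ filter P? (map f (filter Q? (n ∷ []))))
      ≡⟨ length-++ (filter P? (map f (filter Q? (upTo n)))) ⟩
    length (filter P? (map f (filter Q? (upTo n)))) + length (filter P? (map f (filter Q? (n ∷ []))))
      ≡⟨ cong₂ _+_ (length-filter-upTo n) last ⟩
    count (λ d → Q? d ×-dec P? (f d)) (suc n) ∎
    where
    open ≡-Reasoning
    last : length (filter P? (map f (filter Q? (n ∷ [])))) ≡ 𝟙 (Q? n ×-dec P? (f n))
    last with Q? n
    ... | no _ = refl
    ... | yes _ with P? (f n)
    ...   | no _  = refl
    ...   | yes _ = refl

-- Partitions as lists of parts

nth-suc-≤ : ∀ {xs} → Linked _≥_ xs → ∀ a → nth xs (suc a) ≤ nth xs a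
nth-suc-≤ []       _       = z≤n
nth-suc-≤ [-]      zero    = z≤n
nth-suc-≤ [-]      (suc a) = z≤n
nth-suc-≤ (x≥y ∷ _)  zero    = x≥y
nth-suc-≤ (_ ∷ xs)   (suc a) = nth-suc-≤ xs a

antitone⇒≤first : (r : ℕ → ℕ) → (∀ a → r (suc a) ≤ r a) → ∀ a → r a ≤ r 0
antitone⇒≤first r anti zero    = ≤-refl
antitone⇒≤first r anti (suc a) = ≤-trans (anti a) (antitone⇒≤first r anti a)

nth≤first : ∀ {xs} → Linked _≥_ xs → ∀ a → nth xs a ≤ nth xs 0
nth≤first {xs} l = antitone⇒≤first (nth xs) (nth-suc-≤ l)

nth-linked : ∀ xs → (∀ a → nth xs (suc a) ≤ nth xs a) → Linked _≥_ xs
nth-linked []           _ = []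
nth-linked (x ∷ [])     _ = [-]
nth-linked (x ∷ y ∷ xs) f = f 0 ∷ nth-linked (y ∷ xs) (λ a → f (suc a))

nth-<length : ∀ xs {a b} → b < nth xs a → a < length xs
nth-<length (x ∷ xs) {zero}  _   = s≤s z≤n
nth-<length (x ∷ xs) {suc a} b<n = s≤s (nth-<length xs b<n)

sum-take : ∀ xs i → sum (take i xs) ≡ Σ< i (nth xs)
sum-take xs       zero    = refl
sum-take []       (suc i) = sym (trans (Σ-cong (suc i) (λ _ _ → refl)) (Σ-0 (suc i)))
sum-take (x ∷ xs) (suc i) = trans (cong (x +_) (sum-take xs i)) (sym (Σ-++ 1 i (nth (x ∷ xs))))

-- Positivity excludes trailing zeros, which partial sums do not detect.
takes-determine : ∀ {xs ys} → All (0 <_) xs → All (0 <_) ys →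
                  (∀ i → sum (take i xs) ≡ sum (take i ys)) → xs ≡ ys
takes-determine {[]}     {[]}     _ _ _ = refl
takes-determine {[]}     {y ∷ ys} _ (0<y ∷ _) eq =
  contradiction (trans (eq 1) (+-identityʳ y)) (<⇒≢ 0<y)
takes-determine {x ∷ xs} {[]}     (0<x ∷ _) _ eq =
  contradiction (sym (trans (sym (+-identityʳ x)) (eq 1))) (<⇒≢ 0<x)
takes-determine {x ∷ xs} {y ∷ ys} (_ ∷ pxs) (_ ∷ pys) eq with +-cancelʳ-≡ 0 x y (eq 1)
... | refl = cong (x ∷_) (takes-determine pxs pys (λ i → +-cancelˡ-≡ x _ _ (eq (suc i))))

parts-injective : ∀ {α β} → parts α ≡ parts β → α ≡ β
parts-injective {mkPartition xs d p} {mkPartition _ d′ p′} refl =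
  cong₂ (mkPartition xs) (Linked.irrelevant ≤-irrelevant d d′) (All.irrelevant ≤-irrelevant p p′)

⊴-antisym : ∀ {α β} → α ⊴ β → β ⊴ α → α ≡ β
⊴-antisym {α} {β} (_ , α≤β) (_ , β≤α) =
  parts-injective (takes-determine (positive α) (positive β) (λ i → ≤-antisym (α≤β i) (β≤α i)))

nonzeroPrefix : ℕ → (ℕ → ℕ) → List ℕ
nonzeroPrefix zero    r = []
nonzeroPrefix (suc n) r with r 0
... | zero  = []
... | suc x = suc x ∷ nonzeroPrefix n (r ∘ suc)

nonzeroPrefix-positive : ∀ n r → All (0 <_) (nonzeroPrefix n r)
nonzeroPrefix-positive zero    r = []
nonzeroPrefix-positive (suc n) r with r 0
... | zero  = []
... | suc x = s≤s z≤n ∷ nonzeroPrefix-positive n (r ∘ suc)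

-- After its first zero an antitone sequence stays zero, in agreement with the default value of
-- `nth`.
nth-nonzeroPrefix : ∀ n r → (∀ a → r (suc a) ≤ r a) → r n ≡ 0 →
                    ∀ a → nth (nonzeroPrefix n r) a ≡ r a
nth-nonzeroPrefix zero    r r-anti rn≡0 a =
  sym (n≤0⇒n≡0 (≤-trans (antitone⇒≤first r r-anti a) (≤-reflexive rn≡0)))
nth-nonzeroPrefix (suc n) r r-anti rn≡0 a with r 0 in r0≡
... | zero = sym (n≤0⇒n≡0 (≤-trans (antitone⇒≤first r r-anti a) (≤-reflexive r0≡)))
nth-nonzeroPrefix (suc n) r r-anti rn≡0 zero    | suc x = sym r0≡
nth-nonzeroPrefix (suc n) r r-anti rn≡0 (suc a) | suc x =
  nth-nonzeroPrefix n (r ∘ suc) (λ i → r-anti (suc i)) rn≡0 a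

-- Passage between positions and ladder coordinates

module Partitions (m : ℕ) .{{_ : NonZero m}} where
  open Ladders m

  private variable
    a b c d e k : ℕ

  left⇒below : c + m * d ≡ a + m * b → d < b → a < c
  left⇒below eq d<b = ≰⇒> (λ c≤a → <⇒≢ (+-mono-≤-< c≤a (*-monoʳ-< m d<b)) eq)

  below⇒left : c + m * d ≡ a + m * b → a < c → d < b
  below⇒left eq a<c = ≰⇒> (λ b≤d → <⇒≢ (+-mono-<-≤ a<c (*-monoʳ-≤ m b≤d)) (sym eq))

  -- The row is a witness with an equation, since the truncated `k ∸ m * d` would yield row 0 even
  -- where ladder `k` has no position in column `d`.
  OnLadder : (Position → Set) → ℕ → ℕ → Set
  OnLadder P k d = ∃ λ a → a + m * d ≡ k × P (a , d)

  module _ (P : Position → Set) where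

    onLadder⇒ : OnLadder P k d → m * d ≤ k × P (k ∸ m * d , d)
    onLadder⇒ {d = d} (a , refl , p) =
      m≤n+m (m * d) a , subst (λ x → P (x , d)) (sym (m+n∸n≡m a (m * d))) p

    onLadder? : Decidable P → ∀ k d → Dec (OnLadder P k d)
    onLadder? P? k d = map′ to onLadder⇒ ((m * d ≤? k) ×-dec P? (k ∸ m * d , d))
      where
      to : m * d ≤ k × P (k ∸ m * d , d) → OnLadder P k d
      to (v , p) = k ∸ m * d , m∸n+n≡m v , p

    at : OnLadder P (a + m * b) b → P (a , b)
    at {a} {b} (a′ , eq , p) = subst (λ x → P (x , b)) (+-cancelʳ-≡ (m * b) a′ a eq) p

    onLadder-left : (∀ {a d} → P (a , suc d) → P (a , d)) → OnLadder P (m + k) (suc d) → OnLadder P k d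
    onLadder-left {d = d} P-left (a , eq , p) =
      a , +-cancelˡ-≡ m _ _ (trans (index-right a d) eq) , P-left p

    onLadder-up : (∀ {a d} → P (suc a , d) → P (a , d)) → OnLadder P (suc k) d → m * d ≤ k → OnLadder P k d
    onLadder-up P-up (zero  , eq , p) v = contradiction v (<⇒≱ (≤-reflexive (sym eq)))
    onLadder-up P-up (suc a , eq , p) v = a , suc-injective eq , P-up p

  ladder-count : ∀ p {P : Position → Set} (P? : Decidable P) {R : ℕ → Set} (R? : Decidable R) →
                 (∀ {d} → R d → OnLadder P (ladderIndex (suc m) p) d) →
                 (∀ {d} → OnLadder P (ladderIndex (suc m) p) d → R d) →
                 length (filter P? (ladder (suc m) p)) ≡ count R? (suc (ladderIndex (suc m) p))
  ladder-count p {P} P? R? R⇒P P⇒R = trans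
    (length-filter-upTo P? (λ d → m * d ≤? K) (λ d → K ∸ m * d , d) (suc K))
    (count-cong _ R? (suc K)
      (λ d _ (v , x) → P⇒R (K ∸ m * d , m∸n+n≡m v , x))
      (λ d _ r → onLadder⇒ P (R⇒P r)))
    where K = ladderIndex (suc m) p

  module _ (α : Partition) where

    box-up : Box α (suc a , b) → Box α (a , b)
    box-up {a} x = <-≤-trans x (nth-suc-≤ (decreasing α) a)

    box-left : Box α (a , suc b) → Box α (a , b)
    box-left = <-trans ≤-refl

    partitionShape : Shape
    partitionShape = record
      { X     = OnLadder (Box α)
      ; X?    = onLadder? (Box α) (box? α)
      ; valid = λ { (a , refl , _) → m≤n+m _ a }
      ; up    = onLadder-up (Box α) box-up
      ; left  = onLadder-left (Box α) (λ {a} {d} → box-left {a} {d})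
      }

    open Shape partitionShape

    GapsContinueUp⇒GapsUp : a + m * b ≡ suc k → GapsContinueUp (suc m) α (a , b) → GapsUp k b
    GapsContinueUp⇒GapsUp eq g d<b ¬x (c , refl , x) =
      g same (left⇒below same d<b) (λ y → ¬x (suc c , refl , y)) x
      where same = sym eq

    GapsUp⇒GapsContinueUp : a + m * b ≡ suc k → GapsUp k b → GapsContinueUp (suc m) α (a , b)
    GapsUp⇒GapsContinueUp eq g {c} {d} same a<1+c ¬x x =
      g (below⇒left same a<1+c)
        (λ y → ¬x (at (Box α) (subst (λ i → OnLadder (Box α) i d) (trans (sym eq) (sym same)) y)))
        (c , suc-injective (trans same eq) , x)

    locked-left : Locked (suc m) α (a , suc b) → Locked (suc m) α (a , b)
    locked-left l = left-of l ≤-refl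

    locked-up : Locked (suc m) α (suc a , b) → Locked (suc m) α (a , b)
    locked-up (below-locked _ l _) = l
    locked-up (left-of l d<b)      = left-of (locked-up l) d<b

    -- A box locked by rule (II) has a locked right neighbour, so the last locked box of a row comes
    -- from rule (I).
    locked-end : Locked (suc m) α (a , b) → ¬ Locked (suc m) α (a , suc b) →
                 GapsContinueUp (suc m) α (a , b)
    locked-end (first-row _ g)      _  = g
    locked-end (below-locked _ _ g) _  = g
    locked-end (left-of l d<b)      ¬l with m≤n⇒m<n∨m≡n d<b
    ... | inj₁ 1+d<b = contradiction (left-of l 1+d<b) ¬l
    ... | inj₂ refl  = contradiction l ¬l

    module _ (end-gaps : ∀ {a b} → Box α (a , b) → ¬ Box α (a , suc b) →
                         GapsContinueUp (suc m) α (a , b)) where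

      private
        row-locked : ∀ a → (∀ {b} → Box α (a , b) → ¬ Box α (a , suc b) → Locked (suc m) α (a , b)) →
                     ∀ n {b} → nth (parts α) a ≤ n + b → Box α (a , b) → Locked (suc m) α (a , b)
        row-locked a end zero    le x = contradiction x (≤⇒≯ le)
        row-locked a end (suc n) {b} le x with box? α (a , suc b)
        ... | no ¬r = end x ¬r
        ... | yes r = locked-left (row-locked a end n (≤-trans le (≤-reflexive (sym (+-suc n b)))) r)

        rows-locked : ∀ a {b} → Box α (a , b) → Locked (suc m) α (a , b)
        rows-locked zero    = row-locked zero (λ x ¬r → first-row x (end-gaps x ¬r)) _ (m≤m+n _ _)
        rows-locked (suc a) = row-locked (suc a)
          (λ x ¬r → below-locked x (rows-locked a (box-up x)) (end-gaps x ¬r)) _ (m≤m+n _ _)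

      -- Going down the rows, rule (I) locks the last box of each row and rule (II) the rest of it.
      endGaps⇒allLocked : AllLocked (suc m) α
      endGaps⇒allLocked = rows-locked _

    lockedBoxes : Locking
    lockedBoxes = record
      { shape   = partitionShape
      ; L       = OnLadder (Locked (suc m) α)
      ; L?      = onLadder? (Locked (suc m) α) (locked? (suc m) α)
      ; L⇒X     = λ (a , eq , l) → a , eq , locked⇒box (suc m) α l
      ; L-up    = onLadder-up (Locked (suc m) α) locked-up
      ; L-left  = onLadder-left (Locked (suc m) α) locked-left
      ; L-end   = λ { {b = b} (a , eq , l) ¬r → GapsContinueUp⇒GapsUp eq (locked-end l
          (λ r → ¬r (a , trans (sym (index-right a b)) (cong (m +_) eq) , r))) }
      ; L-intro = L-intro
      }
      where
      L-intro : OnLadder (Box α) (suc k) b → (m * b ≤ k → OnLadder (Locked (suc m) α) k b) →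
                GapsUp k b → OnLadder (Locked (suc m) α) (suc k) b
      L-intro (zero  , eq , x) _  g = 0 , eq , first-row x (GapsUp⇒GapsContinueUp eq g)
      L-intro (suc a , refl , x) up g =
        suc a , refl , below-locked x (at (Locked (suc m) α) (up (m≤n+m _ a))) (GapsUp⇒GapsContinueUp refl g)

    indexBound : ℕ
    indexBound = length (parts α) + m * nth (parts α) 0

    box-row : Box α (a , b) → a < length (parts α)
    box-row = nth-<length (parts α)

    box-col : Box α (a , b) → b < nth (parts α) 0
    box-col {a} x = <-≤-trans x (nth≤first (decreasing α) a)

    X-index : X k d → k < indexBound
    X-index (a , refl , x) = +-mono-<-≤ (box-row x) (*-monoʳ-≤ m (<⇒≤ (box-col x)))

    X-col : X k d → d < nth (parts α) 0
    X-col (_ , _ , x) = box-col x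

  -- The partition with a given shape as its diagram

  module _ (S : Shape) {K} (X-index : ∀ {k d} → Shape.X S k d → k < K) where
    open Shape S

    private
      row? : ∀ a b → Dec (X (a + m * b) b)
      row? a b = X? (a + m * b) b

      -- Row and column of a position are at most its ladder index, so `K` bounds rows and columns
      -- as well as ladders.
      rowLength : ℕ → ℕ
      rowLength a = count (row? a) K

      step : X (a + m * suc b) (suc b) → X (a + m * b) b
      step {a} {b} x = left (subst (λ k → X k (suc b)) (sym (index-right a b)) x)

      row-down : e ≤ d → X (a + m * d) d → X (a + m * e) e
      row-down {e} {d} e≤d x with m≤n⇒m<n∨m≡n e≤d
      ... | inj₂ refl = x
      row-down {e} {suc d} _ x | inj₁ (s≤s e≤d) = row-down e≤d (step x)

      row-bound : X (a + m * d) d → d < K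
      row-bound {a} x = ≤-<-trans (≤-trans (m≤n*m _ m) (m≤n+m _ a)) (X-index x)

      rowLength-anti : ∀ a → rowLength (suc a) ≤ rowLength a
      rowLength-anti a = count-mono (row? (suc a)) (row? a) K (λ d _ x → up x (m≤n+m _ a))

      rowLength-K : rowLength K ≡ 0
      rowLength-K = n≤0⇒n≡0 (count≤bound (row? K) K
        (λ d x → contradiction (X-index x) (≤⇒≯ (m≤m+n K _))))

      nth-rows : ∀ a → nth (nonzeroPrefix K rowLength) a ≡ rowLength a
      nth-rows = nth-nonzeroPrefix K rowLength rowLength-anti rowLength-K

    toPartition : Partition
    toPartition = mkPartition (nonzeroPrefix K rowLength)
      (nth-linked _ (λ a → subst₂ _≤_ (sym (nth-rows (suc a))) (sym (nth-rows a)) (rowLength-anti a)))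
      (nonzeroPrefix-positive K rowLength)

    box⇒X : Box toPartition (a , b) → X (a + m * b) b
    box⇒X {a} {b} x = <count⇒ (row? a) row-down row-bound (subst (b <_) (nth-rows a) x)

    X⇒box : X (a + m * b) b → Box toPartition (a , b)
    X⇒box {a} {b} x = subst (b <_) (sym (nth-rows a)) (⇒<count (row? a) row-down row-bound x)

    boxes-toPartition : ∀ k → Shape.boxes (partitionShape toPartition) k ≡ boxes k
    boxes-toPartition k = count-cong _ (X? k) (suc k)
      (λ { d _ (a , refl , x) → box⇒X x })
      (λ d _ x → k ∸ m * d , m∸n+n≡m (valid x) ,
        X⇒box (subst (λ i → X i d) (sym (m∸n+n≡m (valid x))) x))

  -- Regularization classes are given by ladder counts

  ladderBoxes : Partition → ℕ → ℕ
  ladderBoxes α = Shape.boxes (partitionShape α)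

  module _ (k : ℕ) where

    private
      valid? : ∀ d → Dec (m * d ≤ k)
      valid? d = m * d ≤? k

    above? : ∀ d e → Dec (d < e × m * e ≤ k)
    above? d e = (d <? e) ×-dec valid? e

    ladderSize : ℕ
    ladderSize = count valid? (suc k)

    above-count : m * d ≤ k → count (above? d) (suc k) + suc d ≡ ladderSize
    above-count {d} v = sym (trans
      (count-⊎ (above? d) (_<? suc d) valid? (suc k) split (λ _ _ → proj₂)
        (λ _ _ e≤d → *-down (s≤s⁻¹ e≤d) v) (λ _ _ (d<e , _) e≤d → <⇒≱ d<e (s≤s⁻¹ e≤d)))
      (cong (count (above? d) (suc k) +_) (count-< (index-bound v))))
      where
      split : ∀ e → e < suc k → m * e ≤ k → (d < e × m * e ≤ k) ⊎ e < suc d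
      split e _ ve with d <? e
      ... | yes d<e = inj₁ (d<e , ve)
      ... | no d≮e  = inj₂ (s≤s (≮⇒≥ d≮e))

    <ladderSize⇒valid : d < ladderSize → m * d ≤ k
    <ladderSize⇒valid = <count⇒ valid? *-down index-bound

    ladderBoxes≤ladderSize : ∀ α → ladderBoxes α k ≤ ladderSize
    ladderBoxes≤ladderSize α = count-mono _ valid? (suc k) (λ _ _ → Shape.valid (partitionShape α))

  module _ (α : Partition) where

    private
      above≡ : ∀ a b → length (filter (λ q → row q <? a) (ladder (suc m) (a , b))) ≡
                       count (above? (a + m * b) b) (suc (a + m * b))
      above≡ a b = ladder-count (a , b) (λ q → row q <? a) (above? (a + m * b) b)
        (λ { {e} (b<e , v) → _ , m∸n+n≡m v , left⇒below (sym (m∸n+n≡m v)) b<e })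
        (λ { {e} (c , eq , c<a) → below⇒left (sym eq) c<a , ≤-trans (m≤n+m _ c) (≤-reflexive eq) })

      boxes≡ : ∀ p → length (filter (box? α) (ladder (suc m) p)) ≡ ladderBoxes α (ladderIndex (suc m) p)
      boxes≡ p = ladder-count p (box? α) _ (λ x → x) (λ x → x)

    𝓡⇒< : a + m * b ≡ k → 𝓡 (suc m) α (a , b) → count (above? k b) (suc k) < ladderBoxes α k
    𝓡⇒< {a} {b} refl = subst₂ _<_ (above≡ a b) (boxes≡ (a , b))

    <⇒𝓡 : a + m * b ≡ k → count (above? k b) (suc k) < ladderBoxes α k → 𝓡 (suc m) α (a , b)
    <⇒𝓡 {a} {b} refl = subst₂ _<_ (sym (above≡ a b)) (sym (boxes≡ (a , b)))

  𝓡-⊆⇒ladderBoxes-≤ : ∀ α β → (∀ {p} → 𝓡 (suc m) α p → 𝓡 (suc m) β p) →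
                      ∀ k → ladderBoxes α k ≤ ladderBoxes β k
  𝓡-⊆⇒ladderBoxes-≤ α β α⊆β k = ≮⇒≥ absurd
    where
    absurd : ¬ ladderBoxes β k < ladderBoxes α k
    absurd lt = <-irrefl above≡β (𝓡⇒< β index (α⊆β (<⇒𝓡 α index (≤-<-trans (≤-reflexive above≡β) lt))))
      where
      β<n : ladderBoxes β k < ladderSize k
      β<n = <-≤-trans lt (ladderBoxes≤ladderSize k α)
      -- The column with exactly `ladderBoxes β k` positions above it, that is, the highest position
      -- of the ladder outside `𝓡 β`; it and the positions below it number `suc d₀`.
      d₀ = ladderSize k ∸ suc (ladderBoxes β k)
      sum≡ : ladderBoxes β k + suc d₀ ≡ ladderSize k
      sum≡ = trans (+-suc _ d₀) (m+[n∸m]≡n β<n)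
      v₀ : m * d₀ ≤ k
      v₀ = <ladderSize⇒valid k (≤-trans (m≤n+m (suc d₀) _) (≤-reflexive sum≡))
      index : k ∸ m * d₀ + m * d₀ ≡ k
      index = m∸n+n≡m v₀
      above≡β : count (above? k d₀) (suc k) ≡ ladderBoxes β k
      above≡β = +-cancelʳ-≡ (suc d₀) _ _ (trans (above-count k v₀) (sym sum≡))

  𝓡𝓒⇒ladderBoxes-≡ : ∀ α μ → 𝓡𝓒 (suc m) α μ → ∀ k → ladderBoxes μ k ≡ ladderBoxes α k
  𝓡𝓒⇒ladderBoxes-≡ α μ (μ⊆α , α⊆μ) k =
    ≤-antisym (𝓡-⊆⇒ladderBoxes-≤ μ α μ⊆α k) (𝓡-⊆⇒ladderBoxes-≤ α μ α⊆μ k)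

  ladderBoxes-≡⇒𝓡𝓒 : ∀ α μ → (∀ k → ladderBoxes μ k ≡ ladderBoxes α k) → 𝓡𝓒 (suc m) α μ
  ladderBoxes-≡⇒𝓡𝓒 α μ eq =
    (λ r → <⇒𝓡 α refl (<-≤-trans (𝓡⇒< μ refl r) (≤-reflexive (eq _)))) ,
    (λ r → <⇒𝓡 μ refl (<-≤-trans (𝓡⇒< α refl r) (≤-reflexive (sym (eq _)))))

  -- Dominance order through ladders

  topRows? : ∀ i k e → Dec (k < i + m * e)
  topRows? i k e = k <? i + m * e

  module _ (α : Partition) where

    private
      X? : ∀ k d → Dec (OnLadder (Box α) k d)
      X? = Shape.X? (partitionShape α)

    -- Column `b` meets ladder `m * b + a` in row `a`, so summing over ladders is summing over rows
    -- after a shift by `m * b`.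
    column-count : ∀ {i K} b → i + m * b ≤ K →
                   Σ< i (λ a → 𝟙 (box? α (a , b))) ≡ count (λ k → X? k b ×-dec topRows? i k b) K
    column-count {i} {K} b i+mb≤K = sym (begin
      count XR? K                                            ≡⟨ count-stable XR?
                                                                  (≤-trans (≤-reflexive (+-comm (m * b) i)) i+mb≤K)
                                                                  (λ k (_ , k<) → <-≤-trans k< (≤-reflexive (+-comm i (m * b)))) ⟩
      count XR? (m * b + i)                                  ≡⟨ Σ-++ (m * b) i _ ⟩
      count XR? (m * b) + Σ< i (λ a → 𝟙 (XR? (m * b + a)))   ≡⟨ cong₂ _+_ outside (Σ-cong i (λ a a<i →
                                                                  𝟙-cong (XR? (m * b + a)) (box? α (a , b))
                                                                    (inside a) (outward a a<i))) ⟩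
      Σ< i (λ a → 𝟙 (box? α (a , b)))                        ∎)
      where
      open ≡-Reasoning
      XR? : ∀ k → Dec (OnLadder (Box α) k b × k < i + m * b)
      XR? k = X? k b ×-dec topRows? i k b
      outside : count XR? (m * b) ≡ 0
      outside = trans (Σ-cong (m * b) (λ k k<mb → 𝟙-no (XR? k)
        (λ { ((a , refl , _) , _) → <⇒≱ k<mb (m≤n+m (m * b) a) }))) (Σ-0 (m * b))
      inside : ∀ a → OnLadder (Box α) (m * b + a) b × m * b + a < i + m * b → Box α (a , b)
      inside a (x , _) = at (Box α) (subst (λ k → OnLadder (Box α) k b) (+-comm (m * b) a) x)
      outward : ∀ a → a < i → Box α (a , b) → OnLadder (Box α) (m * b + a) b × m * b + a < i + m * b
      outward a a<i x = (a , +-comm a (m * b) , x) ,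
        ≤-<-trans (≤-reflexive (+-comm (m * b) a)) (+-monoˡ-< (m * b) a<i)

    -- A double count: rows are exchanged for columns, then columns for ladders. Positions in the
    -- first `i` rows and `E` columns lie on ladders below `i + m * E`.
    sum-take-ladders : ∀ {E} → nth (parts α) 0 ≤ E → ∀ i →
      sum (take i (parts α)) ≡
      Σ< (i + m * E) (λ k → count (λ e → X? k e ×-dec topRows? i k e) (suc k))
    sum-take-ladders {E} first≤E i = begin
      sum (take i (parts α))
        ≡⟨ sum-take (parts α) i ⟩
      Σ< i (nth (parts α))
        ≡⟨ Σ-cong i (λ a _ → sym (count-< (≤-trans (nth≤first (decreasing α) a) first≤E))) ⟩
      Σ< i (λ a → Σ< E (λ b → 𝟙 (box? α (a , b))))
        ≡⟨ Σ-swap i E _ ⟩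
      Σ< E (λ b → Σ< i (λ a → 𝟙 (box? α (a , b))))
        ≡⟨ Σ-cong E (λ b b<E → column-count b (+-monoʳ-≤ i (*-monoʳ-≤ m (<⇒≤ b<E)))) ⟩
      Σ< E (λ b → Σ< (i + m * E) (λ k → 𝟙 (X? k b ×-dec topRows? i k b)))
        ≡⟨ Σ-swap E (i + m * E) _ ⟩
      Σ< (i + m * E) (λ k → count (λ e → X? k e ×-dec topRows? i k e) E)
        ≡⟨ Σ-cong (i + m * E) (λ k _ → count-stable′ (λ e → X? k e ×-dec topRows? i k e)
             (λ _ (x , _) → index-bound (Shape.valid (partitionShape α) x))
             (λ _ (x , _) → <-≤-trans (X-col α x) first≤E)) ⟩
      Σ< (i + m * E) (λ k → count (λ e → X? k e ×-dec topRows? i k e) (suc k)) ∎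
      where open ≡-Reasoning

    size-ladders : ∀ {E i} → nth (parts α) 0 ≤ E → length (parts α) ≤ i →
                   size α ≡ Σ< (i + m * E) (ladderBoxes α)
    size-ladders {E} {i} first≤E length≤i = begin
      size α                   ≡⟨ cong sum (take-all i (parts α) length≤i) ⟨
      sum (take i (parts α))   ≡⟨ sum-take-ladders first≤E i ⟩
      Σ< (i + m * E) (λ k → count (λ e → X? k e ×-dec topRows? i k e) (suc k))
        ≡⟨ Σ-cong (i + m * E) (λ k _ → count-cong _ (X? k) (suc k) (λ _ _ → proj₁)
             (λ { e _ x@(a , refl , y) → x , +-monoˡ-< (m * e) (<-≤-trans (box-row α y) length≤i) })) ⟩
      Σ< (i + m * E) (ladderBoxes α) ∎
      where open ≡-Reasoning

  -- The first `i` rows cut each ladder in its top part, so `count-top` compares the partial sums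
  -- ladder by ladder.
  allLocked⇒⊴ : ∀ σ μ → AllLocked (suc m) σ → (∀ k → ladderBoxes σ k ≡ ladderBoxes μ k) → σ ⊴ μ
  allLocked⇒⊴ σ μ locked eq =
    trans (size-ladders σ {i = I} σ≤E (m≤m+n _ _))
      (trans (Σ-cong (I + m * E) (λ k _ → eq k)) (sym (size-ladders μ {i = I} μ≤E (m≤n+m _ _)))) ,
    λ i → subst₂ _≤_ (sym (sum-take-ladders σ σ≤E i)) (sym (sum-take-ladders μ μ≤E i))
      (Σ-mono-≤ (i + m * E) (λ k _ → count-top (lockedBoxes σ) (λ (a , eq , x) → a , eq , locked x)
        (nth (parts σ) 0) (X-col σ) (partitionShape μ) eq k (topRows? i k)
        (λ d≤e k< → <-≤-trans k< (+-monoʳ-≤ i (*-monoʳ-≤ m d≤e)))))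
    where
    -- Common bounds on columns and rows, so that both partitions are summed over the same ladders.
    E = nth (parts σ) 0 + nth (parts μ) 0
    I = length (parts σ) + length (parts μ)
    σ≤E : nth (parts σ) 0 ≤ E
    σ≤E = m≤m+n _ _
    μ≤E : nth (parts μ) 0 ≤ E
    μ≤E = m≤n+m _ _

  -- The diagram `𝓢 α` as a partition with all boxes locked

  module _ (α : Partition) where
    open Locking (lockedBoxes α)

    private
      Y-index : Y k d → k < indexBound α
      Y-index (inj₁ (l , _)) = X-index α (L⇒X l)
      Y-index {k} (inj₂ d<h) = ≰⇒> (λ K≤k → <⇒≱ d<h (≤-trans (count≤bound (soft? k) (suc k)
        (λ e (x , _) → contradiction (X-index α x) (≤⇒≯ K≤k))) z≤n))

    lowered : Partition
    lowered = toPartition Y-shape Y-index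

    box⇒Y : Box lowered (a , b) → Y (a + m * b) b
    box⇒Y = box⇒X Y-shape Y-index

    Y⇒box : Y (a + m * b) b → Box lowered (a , b)
    Y⇒box = X⇒box Y-shape Y-index

    lowered-boxes : ∀ k → ladderBoxes lowered k ≡ ladderBoxes α k
    lowered-boxes k = trans (boxes-toPartition Y-shape Y-index k) (Y-boxes k)

    private
      below≡ : ∀ a b →
               length (filter (λ q → (a <? row q) ×-dec ¬? (locked? (suc m) α q)) (ladder (suc m) (a , b))) ≡
                       count (freeBelow? (a + m * b) b) (suc (a + m * b))
      below≡ a b = ladder-count (a , b) (λ q → (a <? row q) ×-dec ¬? (locked? (suc m) α q))
        (freeBelow? (a + m * b) b) to from
        where
        to : FreeBelow (a + m * b) b d → OnLadder (λ q → a < row q × ¬ Locked (suc m) α q) (a + m * b) d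
        to {d} (d<b , ¬l) = _ , index , left⇒below index d<b , λ l → ¬l (_ , index , l)
          where
          index : a + m * b ∸ m * d + m * d ≡ a + m * b
          index = m∸n+n≡m (*-down (<⇒≤ d<b) (m≤n+m (m * b) a))
        from : OnLadder (λ q → a < row q × ¬ Locked (suc m) α q) (a + m * b) d → FreeBelow (a + m * b) b d
        from {d} (c , eq , a<c , ¬l) = below⇒left eq a<c ,
          λ l → ¬l (at (Locked (suc m) α) (subst (λ k → OnLadder (Locked (suc m) α) k d) (sym eq) l))

      unlocked≡ : ∀ p →
                  length (filter (λ q → box? α q ×-dec ¬? (locked? (suc m) α q)) (ladder (suc m) p)) ≡
                        count (unlocked? (ladderIndex (suc m) p)) (suc (ladderIndex (suc m) p))
      unlocked≡ p = ladder-count p (λ q → box? α q ×-dec ¬? (locked? (suc m) α q)) (unlocked? _)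
        (λ { ((a , eq , x) , ¬l) → a , eq , x , λ l → ¬l (a , eq , l) })
        (λ { {d} (a , eq , x , ¬l) → (a , eq , x) ,
          λ l → ¬l (at (Locked (suc m) α) (subst (λ k → OnLadder (Locked (suc m) α) k d) (sym eq) l)) })

    lowered-𝓢 : Box lowered ≐ 𝓢 (suc m) α
    lowered-𝓢 = to , from
      where
      to : ∀ {p} → Box lowered p → 𝓢 (suc m) α p
      to {a , b} x with locked? (suc m) α (a , b)
      ... | yes l = inj₁ l
      ... | no ¬l = inj₂ (¬l , subst₂ _<_ (sym (below≡ a b)) (sym (unlocked≡ (a , b)))
                      (Y⇒fewer (m≤n+m (m * b) a) (λ l → ¬l (at (Locked (suc m) α) l)) (box⇒Y x)))
      from : ∀ {p} → 𝓢 (suc m) α p → Box lowered p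
      from {a , b} (inj₁ l)         = Y⇒box (L⇒Y (a , refl , l))
      from {a , b} (inj₂ (¬l , lt)) = Y⇒box (fewer⇒Y (m≤n+m (m * b) a) (λ l → ¬l (at (Locked (suc m) α) l))
                                        (subst₂ _<_ (below≡ a b) (unlocked≡ (a , b)) lt))

    private
      end-gaps : ∀ {a b} → Box lowered (a , b) → ¬ Box lowered (a , suc b) →
                 GapsContinueUp (suc m) lowered (a , b)
      end-gaps {a} {b} x ¬r {c} {d} same a<1+c ¬y y =
        Y-locked yx (λ yr → ¬r (Y⇒box (subst (λ k → Y k (suc b)) right yr))) (below⇒left same a<1+c)
          (λ z → ¬y (Y⇒box z)) (box⇒Y y)
        where
        yx : Y (suc (c + m * d)) b
        yx = subst (λ k → Y k b) (sym same) (box⇒Y x)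
        right : m + suc (c + m * d) ≡ a + m * suc b
        right = trans (cong (m +_) same) (index-right a b)

    lowered-locked : AllLocked (suc m) lowered
    lowered-locked = endGaps⇒allLocked lowered end-gaps

theorem3p6p2p5 : ∀ (ℓ : ℕ) → 3 ≤ ℓ → (α : Partition) →
    Σ[ σ ∈ Partition ]
    ( Box σ ≐ 𝓢 ℓ α
    × IsUnique (Smallest _⊴_ (𝓡𝓒 ℓ α)) σ
    × IsUnique (λ μ → 𝓡𝓒 ℓ α μ × AllLocked ℓ μ) σ )
theorem3p6p2p5 (suc m@(suc _)) (s≤s (s≤s _)) α =
  lowered α , lowered-𝓢 α ,
  ((σ∈𝓡𝓒 , σ⊴) , λ μ (μ∈𝓡𝓒 , μ⊴) → ⊴-antisym (μ⊴ (lowered α) σ∈𝓡𝓒) (σ⊴ μ μ∈𝓡𝓒)) ,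
  ((σ∈𝓡𝓒 , lowered-locked α) , λ μ (μ∈𝓡𝓒 , locked) →
    -- Any partition of the class with all boxes locked is itself below every member of the class,
    -- in particular below `lowered α`.
    ⊴-antisym (allLocked⇒⊴ μ (lowered α) locked (λ k →
                 trans (𝓡𝓒⇒ladderBoxes-≡ α μ μ∈𝓡𝓒 k) (sym (lowered-boxes α k))))
              (σ⊴ μ μ∈𝓡𝓒))
  where
  open Partitions m
  σ∈𝓡𝓒 : 𝓡𝓒 (suc m) α (lowered α)
  σ∈𝓡𝓒 = ladderBoxes-≡⇒𝓡𝓒 α (lowered α) (lowered-boxes α)
  σ⊴ : ∀ μ → 𝓡𝓒 (suc m) α μ → lowered α ⊴ μ
  σ⊴ μ μ∈𝓡𝓒 = allLocked⇒⊴ (lowered α) μ (lowered-locked α)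
    (λ k → trans (lowered-boxes α k) (sym (𝓡𝓒⇒ladderBoxes-≡ α μ μ∈𝓡𝓒 k)))
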